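{- Let $d\ge2$ and $0<\alpha\le1$. (1) Let $q$ be an odd prime power, $Q$ a nondegenerate quadratic form on $\mathbb F_q^d$, and let $P\subseteq\mathbb F_q^d$ be nonempty. The number of pins $p\in\mathbb F_q^d$ satisfying $|\Delta_p^Q(P)|\le(1-\alpha)q$ is at most $$\frac{(1-\alpha)(q^{d+1}-q^d)}{\alpha^2|P|}.$$ (2) Let $q$ be any prime power, let $Y\subseteq\mathbb F_q^d$ be nonempty, and fix a nondegenerate bilinear pairing $\langle\cdot,\cdot\rangle$ on $\mathbb F_q^d$. Every set of pairwise nonproportional nonzero pins $p\in\mathbb F_q^d$ satisfying $|\Pi_p(Y)|\le(1-\alpha)q$ has cardinality at most $$\frac{(1-\alpha)(q^d-|Y|)}{\alpha^2|Y|}.$$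
   Context: For $p\in\mathbb F_q^d$ and nonempty $P,Y\subseteq\mathbb F_q^d$, $$\Delta_p^Q(P)=\{Q(x-p):x\in P\},\qquad\Pi_p(Y)=\{\langle p,x\rangle:x\in Y\}.$$ -}

module Defs where

open import Level using (Level; _⊔_; 0ℓ) renaming (suc to lsuc)
open import Algebra.Apartness.Structures using (IsHeytingField)
open import Algebra.Bundles using (CommutativeRing)
import Algebra.Definitions.RawMonoid as RawMonoidMult
import Algebra.Properties.Ring as RingProperties
open import Data.Fin.Base using (Fin)
open import Data.Fin.Properties using (inj⇒≟)
open import Data.List.Base as List using (List; length)
import Data.List.Membership.Propositional as ListMembership
open import Data.List.Relation.Unary.Any using (here; there)
open import Data.List.Relation.Unary.Unique.Propositional using (Unique)
import Data.List.Relation.Unary.Unique.DecPropositional.Properties as UniqueProperties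
open import Data.Nat.Base as ℕ using (ℕ; zero; suc; z<s)
open import Data.Nat.Primality using (Prime)
open import Data.Product.Base using (Σ; ∃; _×_; _,_; proj₁; proj₂)
open import Data.Sum.Base using (_⊎_; inj₁; inj₂)
open import Data.Vec.Base as Vec using (Vec)
open import Function.Bundles using (_↔_)
open import Function.Properties.Inverse using (Inverse⇒Injection)
open import Relation.Binary.Core using (Rel)
open import Relation.Binary.Definitions using (DecidableEquality)
open import Relation.Binary.PropositionalEquality.Core using (_≡_; _≢_)
open import Relation.Binary.Structures using (IsStrictPartialOrder)
open import Relation.Nullary.Negation using (¬_)

------------------------------------------------------------------------
-- Ordered fields

-- The real parameter α is taken in an arbitrary ordered field. The axioms
-- are those of constructive ordered fields: neither trichotomy nor a
-- decidable or Archimedean order is required, so that the Cauchy reals, the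
-- Dedekind reals and, classically, every totally ordered field are instances.

record OrderedField (c ℓ₁ ℓ₂ : Level) : Set (lsuc (c ⊔ ℓ₁ ⊔ ℓ₂)) where
  infixl 7 _*_
  infixl 6 _+_
  infix  8 -_
  infix  4 _≈_ _<_ _≤_ _#_
  field
    Carrier : Set c
    _≈_     : Rel Carrier ℓ₁
    _<_     : Rel Carrier ℓ₂
    _+_ _*_ : Carrier → Carrier → Carrier
    -_      : Carrier → Carrier
    0# 1#   : Carrier

  _#_ : Rel Carrier ℓ₂
  x # y = x < y ⊎ y < x

  _≤_ : Rel Carrier ℓ₂
  x ≤ y = ¬ (y < x)

  field
    isHeytingField       : IsHeytingField _≈_ _#_ _+_ _*_ -_ 0# 1#
    isStrictPartialOrder : IsStrictPartialOrder _≈_ _<_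
    +-monoˡ-<            : ∀ {x y} z → x < y → x + z < y + z
    *-pos                : ∀ {x y} → 0# < x → 0# < y → 0# < x * y

  open IsHeytingField isHeytingField public
    using (isCommutativeRing; _-_; #⇒invertible; invertible⇒#)

  commutativeRing : CommutativeRing c ℓ₁
  commutativeRing = record { isCommutativeRing = isCommutativeRing }

  private
    module R = CommutativeRing commutativeRing
    module O = IsStrictPartialOrder isStrictPartialOrder

  fromℕ : ℕ → Carrier
  fromℕ n = RawMonoidMult._×_ R.+-rawMonoid n 1#

  -- The library's inverse is one of y - 0#, which is y.
  divide : (x y : Carrier) → 0# < y → Carrier
  divide x y 0<y = x * proj₁ (#⇒invertible {y} {0#} (inj₂ 0<y))

  syntax divide x y 0<y = x / y [ 0<y ]

  <-resp : ∀ {x x′ y y′} → x ≈ x′ → y ≈ y′ → x < y → x′ < y′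
  <-resp x≈x′ y≈y′ x<y = proj₁ O.<-resp-≈ y≈y′ (proj₂ O.<-resp-≈ x≈x′ x<y)

  0<1 : 0# < 1#
  0<1 with invertible⇒# {1#} {0#}
             (1# , R.trans (R.*-identityˡ (1# - 0#)) 1-0≈1
                 , R.trans (R.*-identityʳ (1# - 0#)) 1-0≈1)
    where
    1-0≈1 : 1# - 0# ≈ 1#
    1-0≈1 = R.trans (R.+-congˡ (RingProperties.-0#≈0# R.ring)) (R.+-identityʳ 1#)
  ... | inj₂ 0<1 = 0<1
  ... | inj₁ 1<0 = <-resp R.refl -1*-1≈1 (*-pos 0<-1 0<-1)
    where
    0<-1 : 0# < - 1#
    0<-1 = <-resp (R.-‿inverseʳ 1#) (R.+-identityˡ (- 1#)) (+-monoˡ-< (- 1#) 1<0)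

    -1*-1≈1 : - 1# * - 1# ≈ 1#
    -1*-1≈1 = R.trans (RingProperties.-1*x≈-x R.ring (- 1#))
                      (RingProperties.-‿involutive R.ring 1#)

  fromℕ-suc-pos : ∀ n → 0# < fromℕ (suc n)
  fromℕ-suc-pos zero    = <-resp R.refl (R.sym (R.+-identityʳ 1#)) 0<1
  fromℕ-suc-pos (suc n) =
    O.trans (fromℕ-suc-pos n)
            (<-resp (R.+-identityˡ (fromℕ (suc n))) R.refl
                    (+-monoˡ-< (fromℕ (suc n)) 0<1))

  fromℕ-pos : ∀ {n} → 0 ℕ.< n → 0# < fromℕ n
  fromℕ-pos {suc n} _ = fromℕ-suc-pos n

  α²n-pos : ∀ {α n} → 0# < α → 0 ℕ.< n → 0# < α * α * fromℕ n
  α²n-pos 0<α 0<n = *-pos (*-pos 0<α 0<α) (fromℕ-pos 0<n)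

------------------------------------------------------------------------
-- Finite subsets

record FinSubset {a} (A : Set a) : Set a where
  field
    elements : List A
    unique   : Unique elements

open FinSubset public

infix 4 _∈_

_∈_ : ∀ {a} {A : Set a} → A → FinSubset A → Set a
x ∈ S = ListMembership._∈_ x (elements S)

∣_∣ : ∀ {a} {A : Set a} → FinSubset A → ℕ
∣ S ∣ = length (elements S)

Nonempty : ∀ {a} {A : Set a} → FinSubset A → Set a
Nonempty S = ∃ λ x → x ∈ S

Nonempty⇒0<∣∣ : ∀ {a} {A : Set a} (S : FinSubset A) → Nonempty S → 0 ℕ.< ∣ S ∣
Nonempty⇒0<∣∣ S (x , x∈S) = go x∈S
  where
  go : ∀ {xs} → ListMembership._∈_ x xs → 0 ℕ.< length xs
  go (here _)  = z<s
  go (there _) = z<s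

image : ∀ {a b} {A : Set a} {B : Set b} →
        DecidableEquality B → (A → B) → FinSubset A → FinSubset B
image _≟_ f S = record
  { elements = List.deduplicate _≟_ (List.map f (elements S))
  ; unique   = UniqueProperties.deduplicate-! _≟_ (List.map f (elements S))
  }

------------------------------------------------------------------------
-- Finite fields

IsPrimePower : ℕ → Set
IsPrimePower q = Σ ℕ λ p → Σ ℕ λ k → Prime p × 1 ℕ.≤ k × q ≡ p ℕ.^ k

-- A field with exactly q elements; for _#_ = _≢_ the library's Heyting fields
-- are ordinary fields (in particular 0# ≢ 1#).
record FiniteField (q : ℕ) : Set₁ where
  infixl 7 _*_
  infixl 6 _+_
  infix  8 -_
  field
    Carrier        : Set
    _+_ _*_        : Carrier → Carrier → Carrier
    -_             : Carrier → Carrier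
    0# 1#          : Carrier
    isHeytingField : IsHeytingField _≡_ _≢_ _+_ _*_ -_ 0# 1#
    enumeration    : Carrier ↔ Fin q

  open IsHeytingField isHeytingField public using (_-_)

  _≟_ : DecidableEquality Carrier
  _≟_ = inj⇒≟ (Inverse⇒Injection enumeration)

------------------------------------------------------------------------
-- The space 𝔽_q^d, quadratic forms and pairings on it

module Space {q : ℕ} (F : FiniteField q) (d : ℕ) where
  open FiniteField F

  infixl 6 _+ᵛ_ _-ᵛ_
  infixr 7 _•_

  Point : Set
  Point = Vec Carrier d

  _+ᵛ_ _-ᵛ_ : Point → Point → Point
  _+ᵛ_ = Vec.zipWith _+_
  _-ᵛ_ = Vec.zipWith _-_

  _•_ : Carrier → Point → Point
  c • x = Vec.map (c *_) x

  0ᵛ : Point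
  0ᵛ = Vec.replicate d 0#

  record IsBilinear (B : Point → Point → Carrier) : Set where
    field
      +-linearˡ : ∀ x y z → B (x +ᵛ y) z ≡ B x z + B y z
      +-linearʳ : ∀ x y z → B x (y +ᵛ z) ≡ B x y + B x z
      •-linearˡ : ∀ c x y → B (c • x) y ≡ c * B x y
      •-linearʳ : ∀ c x y → B x (c • y) ≡ c * B x y

  record IsNondegenerateBilinear (B : Point → Point → Carrier) : Set where
    field
      isBilinear     : IsBilinear B
      nondegenerateˡ : ∀ x → (∀ y → B x y ≡ 0#) → x ≡ 0ᵛ
      nondegenerateʳ : ∀ y → (∀ x → B x y ≡ 0#) → y ≡ 0ᵛ

  polar : (Point → Carrier) → Point → Point → Carrier
  polar Q x y = Q (x +ᵛ y) - Q x - Q y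

  record IsQuadraticForm (Q : Point → Carrier) : Set where
    field
      homogeneous     : ∀ c x → Q (c • x) ≡ c * c * Q x
      polar-bilinear  : IsBilinear (polar Q)

  -- Only meant for odd q, where polar Q is twice the symmetric bilinear form
  -- B with Q x = B x x.
  record IsNondegenerateQuadraticForm (Q : Point → Carrier) : Set where
    field
      isQuadraticForm     : IsQuadraticForm Q
      polar-nondegenerate : IsNondegenerateBilinear (polar Q)

  Δ : (Point → Carrier) → Point → FinSubset Point → FinSubset Carrier
  Δ Q p P = image _≟_ (λ x → Q (x -ᵛ p)) P

  Π : (Point → Point → Carrier) → Point → FinSubset Point → FinSubset Carrier
  Π B p Y = image _≟_ (λ x → B p x) Y

  Proportional : Point → Point → Set
  Proportional x y = ∃ λ c → x ≡ c • y

  PairwiseNonproportional : FinSubset Point → Set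
  PairwiseNonproportional S =
    ∀ {x y} → x ∈ S → y ∈ S → x ≢ y → ¬ Proportional x y

{-# OPTIONS --safe #-}

-- Let N be the size of the point set and M(p) the number of ordered pairs of its points
-- to which the pin p assigns the same value. By Cauchy–Schwarz N² ≤ |values at p| · M(p),
-- so a pin in the exceptional set satisfies N² ≤ (1 − α) q M(p), whereas every pin satisfies
-- N² ≤ q M(p). For two distinct points, translating the pin along a suitable direction
-- changes the difference of its two values by an arbitrary scalar, so at most a fraction 1/q of
-- all pins identify them. Double counting then bounds the total excess Σ (q M(p) − N²) over
-- all pins by N (q^(d+1) − q^d), and its terms are nonnegative.
-- For (1) this bounds the excess of the exceptional pins. For (2) the excess is invariant
-- under p ↦ s p with s ≠ 0, the q − 1 multiples of the exceptional pins are distinct, and the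
-- pin 0 has excess (q − 1) N²; dividing by q − 1 leaves N (q^d − N).

module Submission where

open import Defs
open import Algebra.Apartness.Structures using (IsHeytingField)
open import Algebra.Bundles using (CommutativeRing)
import Algebra.Properties.AbelianGroup as AbelianGroupProperties
import Algebra.Properties.CommutativeSemigroup as CommutativeSemigroupProperties
import Algebra.Properties.Group as GroupProperties
import Algebra.Properties.Monoid.Mult as MonoidMult
import Algebra.Properties.Ring as RingProperties
import Algebra.Properties.Semiring.Mult as SemiringMult
import Algebra.Solver.Ring.NaturalCoefficients.Default as NaturalCoefficients
open import Data.List.Base
  using (List; []; _∷_; map; length; _++_; allFin; filter; cartesianProduct; cartesianProductWith)
open import Data.List.Membership.Propositional using (lose; find) renaming (_∈_ to _∈ₗ_)
open import Data.List.Membership.Propositional.Properties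
  using (∈-∃++; ∈-++⁻; ∈-++⁺ˡ; ∈-++⁺ʳ; ∈-map⁺; ∈-allFin; ∈-filter⁺; ∈-filter⁻;
         ∈-cartesianProductWith⁺; ∈-cartesianProduct⁻; ∈-deduplicate⁺)
open import Data.List.Properties using (length-map; length-tabulate; length-++)
open import Data.List.Relation.Unary.All as All using ([]; _∷_)
open import Data.List.Relation.Unary.Any using (here; there; any?)
open import Data.List.Relation.Unary.Unique.Propositional using (Unique; []; _∷_)
import Data.List.Relation.Unary.Unique.Propositional.Properties as Unique
open import Data.Nat.Base as ℕ using (ℕ; zero; suc; _^_)
open import Data.Nat.Divisibility using (_∣_)
import Data.Nat.Properties as ℕ
open import Data.Nat.Tactic.RingSolver using (solve-∀)
open import Data.Product.Base using (_×_; _,_; ∃; proj₁; proj₂; uncurry)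
open import Data.Sum.Base using (inj₁; inj₂)
open import Data.Vec.Base as Vec using (Vec; []; _∷_)
import Data.Vec.Properties as Vec
open import Function.Base using (_∘_)
open import Function.Bundles using (Inverse)
open import Relation.Binary.Bundles using (Preorder)
open import Relation.Binary.Definitions using (DecidableEquality)
open import Relation.Binary.PropositionalEquality as ≡ using (_≡_; _≢_)
import Relation.Binary.Reasoning.Preorder as PreorderReasoning
import Relation.Binary.Reasoning.Setoid as SetoidReasoning
open import Relation.Binary.Structures using (IsStrictPartialOrder)
open import Relation.Nullary using (Dec; yes; no; ¬_; ¬?; contradiction; decidable-stable)

-- Finite sums of natural numbers over lists.

module Sums where
  open import Data.Nat.Base
  open import Data.Nat.Properties
  open ≡ using (refl; sym; trans; cong; cong₂; subst₂; module ≡-Reasoning)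

  ∑ : ∀ {a} {A : Set a} → List A → (A → ℕ) → ℕ
  ∑ []       f = 0
  ∑ (x ∷ xs) f = f x + ∑ xs f

  -- The Iverson bracket, through which cardinalities become sums that can be swapped and reindexed.
  ⟦_⟧ : ∀ {a} {A : Set a} → Dec A → ℕ
  ⟦ yes _ ⟧ = 1
  ⟦ no  _ ⟧ = 0

  ⟦⟧-mono : ∀ {a b} {A : Set a} {B : Set b} (A? : Dec A) (B? : Dec B) →
            (A → B) → ⟦ A? ⟧ ≤ ⟦ B? ⟧
  ⟦⟧-mono (no _)  _        A⇒B = z≤n
  ⟦⟧-mono (yes _) (yes _)  A⇒B = ≤-refl
  ⟦⟧-mono (yes a) (no ¬b)  A⇒B = contradiction (A⇒B a) ¬b

  ⟦⟧-cong : ∀ {a b} {A : Set a} {B : Set b} (A? : Dec A) (B? : Dec B) →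
            (A → B) → (B → A) → ⟦ A? ⟧ ≡ ⟦ B? ⟧
  ⟦⟧-cong A? B? A⇒B B⇒A = ≤-antisym (⟦⟧-mono A? B? A⇒B) (⟦⟧-mono B? A? B⇒A)

  ⟦⟧-true : ∀ {a} {A : Set a} (A? : Dec A) → A → ⟦ A? ⟧ ≡ 1
  ⟦⟧-true (yes _) _ = refl
  ⟦⟧-true (no ¬a) a = contradiction a ¬a

  ⟦⟧-false : ∀ {a} {A : Set a} (A? : Dec A) → ¬ A → ⟦ A? ⟧ ≡ 0
  ⟦⟧-false (yes a) ¬a = contradiction a ¬a
  ⟦⟧-false (no _)  _  = refl

  module _ {a} {A : Set a} where

    ∑-cong : ∀ (xs : List A) {f g : A → ℕ} → (∀ {x} → x ∈ₗ xs → f x ≡ g x) → ∑ xs f ≡ ∑ xs g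
    ∑-cong []       f≡g = refl
    ∑-cong (x ∷ xs) f≡g = cong₂ _+_ (f≡g (here refl)) (∑-cong xs (f≡g ∘ there))

    ∑-mono : ∀ (xs : List A) {f g : A → ℕ} → (∀ {x} → x ∈ₗ xs → f x ≤ g x) → ∑ xs f ≤ ∑ xs g
    ∑-mono []       f≤g = z≤n
    ∑-mono (x ∷ xs) f≤g = +-mono-≤ (f≤g (here refl)) (∑-mono xs (f≤g ∘ there))

    ∑-const : ∀ (xs : List A) c → ∑ xs (λ _ → c) ≡ length xs * c
    ∑-const []       c = refl
    ∑-const (x ∷ xs) c = cong (c +_) (∑-const xs c)

    ∑-zero : ∀ (xs : List A) → ∑ xs (λ _ → 0) ≡ 0
    ∑-zero []       = refl
    ∑-zero (x ∷ xs) = ∑-zero xs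

    ∑-++ : ∀ (xs ys : List A) f → ∑ (xs ++ ys) f ≡ ∑ xs f + ∑ ys f
    ∑-++ []       ys f = refl
    ∑-++ (x ∷ xs) ys f = trans (cong (f x +_) (∑-++ xs ys f)) (sym (+-assoc (f x) _ _))

    ∑-+ : ∀ (xs : List A) f g → ∑ xs (λ x → f x + g x) ≡ ∑ xs f + ∑ xs g
    ∑-+ []       f g = refl
    ∑-+ (x ∷ xs) f g = trans (cong (f x + g x +_) (∑-+ xs f g)) (interchange (f x) (g x) _ _)
      where
      interchange : ∀ i j k l → i + j + (k + l) ≡ i + k + (j + l)
      interchange = solve-∀

    ∑-*ˡ : ∀ (xs : List A) c f → ∑ xs (λ x → c * f x) ≡ c * ∑ xs f
    ∑-*ˡ []       c f = sym (*-zeroʳ c)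
    ∑-*ˡ (x ∷ xs) c f = trans (cong (c * f x +_) (∑-*ˡ xs c f)) (sym (*-distribˡ-+ c (f x) _))

    ∑-*ʳ : ∀ (xs : List A) f c → ∑ xs (λ x → f x * c) ≡ ∑ xs f * c
    ∑-*ʳ []       f c = refl
    ∑-*ʳ (x ∷ xs) f c = trans (cong (f x * c +_) (∑-*ʳ xs f c)) (sym (*-distribʳ-+ c (f x) _))

    -- Reordering and restricting a sum at once: xs is mapped injectively into ys.
    ∑-inj : ∀ {b} {B : Set b} (ys : List A) (xs : List B) (h : B → A) (f : A → ℕ) →
            Unique xs → (∀ {x} → x ∈ₗ xs → h x ∈ₗ ys) →
            (∀ {x y} → x ∈ₗ xs → y ∈ₗ xs → h x ≡ h y → x ≡ y) →
            ∑ xs (f ∘ h) ≤ ∑ ys f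
    ∑-inj ys []       h f _          _   _     = z≤n
    ∑-inj ys (x ∷ xs) h f (x∉ ∷ xs!) h∈ h-inj with ∈-∃++ (h∈ (here refl))
    ... | as , bs , refl = begin
      f (h x) + ∑ xs (f ∘ h)
        ≤⟨ +-monoʳ-≤ (f (h x)) (∑-inj (as ++ bs) xs h f xs! ∈rest (λ i j → h-inj (there i) (there j))) ⟩
      f (h x) + ∑ (as ++ bs) f           ≡⟨ cong (f (h x) +_) (∑-++ as bs f) ⟩
      f (h x) + (∑ as f + ∑ bs f)        ≡⟨ x∙yz≡y∙xz (f (h x)) (∑ as f) (∑ bs f) ⟩
      ∑ as f + (f (h x) + ∑ bs f)        ≡⟨ ∑-++ as (h x ∷ bs) f ⟨
      ∑ (as ++ h x ∷ bs) f               ∎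
      where
      open ≤-Reasoning
      x∙yz≡y∙xz : ∀ i j k → i + (j + k) ≡ j + (i + k)
      x∙yz≡y∙xz = solve-∀
      ∈rest : ∀ {y} → y ∈ₗ xs → h y ∈ₗ as ++ bs
      ∈rest y∈ with ∈-++⁻ as (h∈ (there y∈))
      ... | inj₁ i           = ∈-++⁺ˡ i
      ... | inj₂ (there i)   = ∈-++⁺ʳ as i
      ... | inj₂ (here hy≡hx) = contradiction (h-inj (here refl) (there y∈) (sym hy≡hx)) (All.lookup x∉ y∈)

    ∑-⊆ : ∀ (xs ys : List A) f → Unique xs → (∀ {x} → x ∈ₗ xs → x ∈ₗ ys) → ∑ xs f ≤ ∑ ys f
    ∑-⊆ xs ys f xs! xs⊆ys = ∑-inj ys xs (λ x → x) f xs! xs⊆ys (λ _ _ eq → eq)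

    length-⊆ : ∀ (xs ys : List A) → Unique xs → (∀ {x} → x ∈ₗ xs → x ∈ₗ ys) → length xs ≤ length ys
    length-⊆ xs ys xs! xs⊆ys = subst₂ _≤_ (length≡∑1 xs) (length≡∑1 ys) (∑-⊆ xs ys (λ _ → 1) xs! xs⊆ys)
      where
      length≡∑1 : ∀ zs → ∑ zs (λ _ → 1) ≡ length zs
      length≡∑1 zs = trans (∑-const zs 1) (*-identityʳ (length zs))

    ∑-atMostOne : ∀ {p} {P : A → Set p} (P? : ∀ x → Dec (P x)) (xs : List A) → Unique xs →
                  (∀ {x y} → P x → P y → x ≡ y) → ∑ xs (λ x → ⟦ P? x ⟧) ≤ 1
    ∑-atMostOne P? []       _          _   = z≤n
    ∑-atMostOne P? (x ∷ xs) (x∉ ∷ xs!) P-irr with P? x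
    ... | no  _  = ∑-atMostOne P? xs xs! P-irr
    ... | yes Px = s≤s (≤-reflexive (trans
            (∑-cong xs (λ {y} y∈ → ⟦⟧-false (P? y) (λ Py → All.lookup x∉ y∈ (P-irr Px Py))))
            (∑-zero xs)))

    module _ (_≟_ : DecidableEquality A) where

      ∑-δ : ∀ (xs : List A) (f : A → ℕ) {x} → Unique xs → x ∈ₗ xs → ∑ xs (λ y → ⟦ x ≟ y ⟧ * f y) ≡ f x
      ∑-δ (x ∷ xs) f (x∉ ∷ xs!) (here refl) = begin
        ⟦ x ≟ x ⟧ * f x + ∑ xs (λ y → ⟦ x ≟ y ⟧ * f y)
          ≡⟨ cong₂ _+_ (cong (_* f x) (⟦⟧-true (x ≟ x) refl)) (trans (∑-cong xs x≢) (∑-zero xs)) ⟩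
        1 * f x + 0                                     ≡⟨ +-identityʳ (1 * f x) ⟩
        1 * f x                                         ≡⟨ *-identityˡ (f x) ⟩
        f x                                             ∎
        where
        open ≡-Reasoning
        x≢ : ∀ {y} → y ∈ₗ xs → ⟦ x ≟ y ⟧ * f y ≡ 0
        x≢ {y} y∈ = cong (_* f y) (⟦⟧-false (x ≟ y) (All.lookup x∉ y∈))
      ∑-δ (z ∷ xs) f {x} (z∉ ∷ xs!) (there x∈) =
        cong₂ _+_ (cong (_* f z) (⟦⟧-false (x ≟ z) (λ x≡z → All.lookup z∉ x∈ (sym x≡z)))) (∑-δ xs f xs! x∈)

  ∑-swap : ∀ {a b} {A : Set a} {B : Set b} (xs : List A) (ys : List B) (f : A → B → ℕ) →
           ∑ xs (λ x → ∑ ys (f x)) ≡ ∑ ys (λ y → ∑ xs (λ x → f x y))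
  ∑-swap []       ys f = sym (∑-zero ys)
  ∑-swap (x ∷ xs) ys f = trans (cong (∑ ys (f x) +_) (∑-swap xs ys f)) (sym (∑-+ ys (f x) _))

  ∑-map : ∀ {a b} {A : Set a} {B : Set b} (xs : List A) (h : A → B) (f : B → ℕ) →
          ∑ (map h xs) f ≡ ∑ xs (f ∘ h)
  ∑-map []       h f = refl
  ∑-map (x ∷ xs) h f = cong (f (h x) +_) (∑-map xs h f)

  -- Cauchy-Schwarz and the counting of collisions.

  2mn≤m²+n² : ∀ m n → 2 * (m * n) ≤ m * m + n * n
  2mn≤m²+n² m n with ≤-total m n
  -- With the larger number written as the smaller one plus `k`, the two sides differ by `k * k`, so
  -- no subtraction occurs.
  ... | inj₁ m≤n with k , refl ← m≤n⇒∃[o]m+o≡n m≤n = m+n≤o⇒m≤o _ (≤-reflexive (expand m k))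
    where
    expand : ∀ m k → 2 * (m * (m + k)) + k * k ≡ m * m + (m + k) * (m + k)
    expand = solve-∀
  ... | inj₂ n≤m with k , refl ← m≤n⇒∃[o]m+o≡n n≤m = m+n≤o⇒m≤o _ (≤-reflexive (expand n k))
    where
    expand : ∀ n k → 2 * ((n + k) * n) + k * k ≡ (n + k) * (n + k) + n * n
    expand = solve-∀

  -- Induction on the list. The new cross term `2 * (c * s)` splits into one term for each later
  -- entry, and each of these is bounded by a sum of two squares.
  cauchySchwarz : ∀ {a} {A : Set a} (xs : List A) (f : A → ℕ) →
                  ∑ xs f * ∑ xs f ≤ length xs * ∑ xs (λ x → f x * f x)
  cauchySchwarz []       f = z≤n
  cauchySchwarz (x ∷ xs) f = begin
    (c + s) * (c + s)                    ≡⟨ square c s ⟩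
    c * c + 2 * (c * s) + s * s          ≤⟨ +-mono-≤ (+-monoʳ-≤ (c * c) cross) (cauchySchwarz xs f) ⟩
    c * c + (n * (c * c) + t) + n * t    ≡⟨ regroup (c * c) n t ⟩
    suc n * (c * c + t)                  ∎
    where
    open ≤-Reasoning
    c = f x
    s = ∑ xs f
    n = length xs
    t = ∑ xs (λ y → f y * f y)
    square : ∀ c s → (c + s) * (c + s) ≡ c * c + 2 * (c * s) + s * s
    square = solve-∀
    regroup : ∀ e n t → e + (n * e + t) + n * t ≡ suc n * (e + t)
    regroup = solve-∀
    cross : 2 * (c * s) ≤ n * (c * c) + t
    cross = begin
      2 * (c * s)                          ≡⟨ cong (2 *_) (∑-*ˡ xs c f) ⟨
      2 * ∑ xs (λ y → c * f y)             ≡⟨ ∑-*ˡ xs 2 _ ⟨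
      ∑ xs (λ y → 2 * (c * f y))           ≤⟨ ∑-mono xs (λ {y} _ → 2mn≤m²+n² c (f y)) ⟩
      ∑ xs (λ y → c * c + f y * f y)       ≡⟨ ∑-+ xs (λ _ → c * c) _ ⟩
      ∑ xs (λ _ → c * c) + t               ≡⟨ cong (_+ t) (∑-const xs (c * c)) ⟩
      n * (c * c) + t                      ∎

  module _ {a b} {A : Set a} {B : Set b} (_≟_ : DecidableEquality B) where

    -- Pairs are ordered and include the diagonal, which makes this the second moment of the fibre
    -- sizes of `f`.
    collisions : (A → B) → List A → ℕ
    collisions f xs = ∑ xs (λ x → ∑ xs (λ y → ⟦ f y ≟ f x ⟧))

    -- Cauchy-Schwarz for the fibre sizes `ν`. The list `vs` may contain values that are not
    -- attained: the image of a pin serves for exceptional pins, and the list of all scalars for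
    -- arbitrary ones.
    length²≤∣values∣*collisions : ∀ (f : A → B) (xs : List A) (vs : List B) → Unique vs →
      (∀ {x} → x ∈ₗ xs → f x ∈ₗ vs) → length xs * length xs ≤ length vs * collisions f xs
    length²≤∣values∣*collisions f xs vs vs! f∈vs = begin
      length xs * length xs            ≡⟨ cong₂ _*_ ∑ν ∑ν ⟨
      ∑ vs ν * ∑ vs ν                  ≤⟨ cauchySchwarz vs ν ⟩
      length vs * ∑ vs (λ t → ν t * ν t) ≡⟨ cong (length vs *_) ∑ν² ⟩
      length vs * collisions f xs      ∎
      where
      open ≤-Reasoning
      ν : B → ℕ
      ν t = ∑ xs (λ x → ⟦ f x ≟ t ⟧)
      -- Summation over the fibres of `f`. The weight 1 yields the first moment of `ν`, and the
      -- weight `ν` itself yields the second.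
      weighted : ∀ (g : B → ℕ) → ∑ vs (λ t → ν t * g t) ≡ ∑ xs (g ∘ f)
      weighted g = begin-equality
        ∑ vs (λ t → ν t * g t)                         ≡⟨ ∑-cong vs (λ {t} _ → sym (∑-*ʳ xs _ (g t))) ⟩
        ∑ vs (λ t → ∑ xs (λ x → ⟦ f x ≟ t ⟧ * g t))    ≡⟨ ∑-swap vs xs _ ⟩
        ∑ xs (λ x → ∑ vs (λ t → ⟦ f x ≟ t ⟧ * g t))
          ≡⟨ ∑-cong xs (λ x∈ → ∑-δ _≟_ vs g vs! (f∈vs x∈)) ⟩
        ∑ xs (g ∘ f)                                   ∎
      ∑ν : ∑ vs ν ≡ length xs
      ∑ν = begin-equality
        ∑ vs ν                    ≡⟨ ∑-cong vs (λ _ → sym (*-identityʳ _)) ⟩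
        ∑ vs (λ t → ν t * 1)      ≡⟨ weighted (λ _ → 1) ⟩
        ∑ xs (λ _ → 1)            ≡⟨ ∑-const xs 1 ⟩
        length xs * 1             ≡⟨ *-identityʳ _ ⟩
        length xs                 ∎
      ∑ν² : ∑ vs (λ t → ν t * ν t) ≡ collisions f xs
      ∑ν² = weighted ν

  length-cartesianProductWith : ∀ {a b c} {A : Set a} {B : Set b} {C : Set c} (f : A → B → C) xs ys →
    length (cartesianProductWith f xs ys) ≡ length xs ℕ.* length ys
  length-cartesianProductWith f []       ys = refl
  length-cartesianProductWith f (x ∷ xs) ys = trans (length-++ (map (f x) ys))
    (cong₂ _+_ (length-map (f x) ys) (length-cartesianProductWith f xs ys))

  ∑-cartesianProduct : ∀ {a b} {A : Set a} {B : Set b} (xs : List A) (ys : List B) (f : A × B → ℕ) →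
    ∑ (cartesianProduct xs ys) f ≡ ∑ xs (λ x → ∑ ys (λ y → f (x , y)))
  ∑-cartesianProduct []       ys f = refl
  ∑-cartesianProduct (x ∷ xs) ys f = trans (∑-++ (map (x ,_) ys) _ f)
    (cong₂ _+_ (∑-map ys (x ,_) f) (∑-cartesianProduct xs ys f))

open Sums

-- Cancellation identities in commutative rings.

module RingIdentities {c ℓ} (R : CommutativeRing c ℓ) where

  open CommutativeRing R
  open GroupProperties +-group using (//-rightDividesˡ; //-rightDividesʳ; \\-leftDividesʳ)
  open RingProperties ring using (-0#≈0#)
  open SetoidReasoning setoid

  x-0≈x : ∀ x → x - 0# ≈ x
  x-0≈x x = trans (+-congˡ -0#≈0#) (+-identityʳ x)

  x+z-z≈x : ∀ x z → x + z - z ≈ x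
  x+z-z≈x x z = //-rightDividesʳ z x

  x-z+z≈x : ∀ x z → x - z + z ≈ x
  x-z+z≈x x z = //-rightDividesˡ z x

  -x+[x+y]≈y : ∀ x y → - x + (x + y) ≈ y
  -x+[x+y]≈y = \\-leftDividesʳ

  [x-y]+[y-z]≈x-z : ∀ x y z → (x - y) + (y - z) ≈ x - z
  [x-y]+[y-z]≈x-z x y z = begin
    (x - y) + (y - z)  ≈⟨ +-assoc (x - y) y (- z) ⟨
    (x - y + y) - z    ≈⟨ +-congʳ (x-z+z≈x x y) ⟩
    x - z              ∎

  x≈⟨1-a⟩x+ax : ∀ a x → x ≈ (1# - a) * x + a * x
  x≈⟨1-a⟩x+ax a x = begin
    x                     ≈⟨ *-identityˡ x ⟨
    1# * x                ≈⟨ *-congʳ (x-z+z≈x 1# a) ⟨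
    (1# - a + a) * x      ≈⟨ distribʳ x (1# - a) a ⟩
    (1# - a) * x + a * x  ∎

-- Inequalities in a constructive ordered field.

module OrderedFieldProperties {c ℓ₁ ℓ₂} (K : OrderedField c ℓ₁ ℓ₂) where
  open OrderedField K
  open CommutativeRing commutativeRing
    using (refl; reflexive; distribˡ; +-comm; +-assoc; sym; trans; +-cong; +-congˡ; +-congʳ;
           *-congˡ; *-congʳ; isEquivalence; semiring; commutativeSemiring; +-monoid; ring;
           -‿inverseʳ; +-identityˡ; +-identityʳ; *-identityʳ; *-identityˡ; *-comm; *-assoc; zeroˡ;
           zeroʳ)
  open RingIdentities commutativeRing
  open RingProperties ring using (x[y-z]≈xy-xz)

  private
    open NaturalCoefficients commutativeSemiring using (solve; _:=_; _:+_; _:*_)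
    module O = IsStrictPartialOrder isStrictPartialOrder
    module H = IsHeytingField isHeytingField

  ≤-reflexive : ∀ {x y} → x ≈ y → x ≤ y
  ≤-reflexive x≈y y<x = O.irrefl (sym x≈y) y<x

  ≤-trans : ∀ {x y z} → x ≤ y → y ≤ z → x ≤ z
  ≤-trans {x} {y} {z} x≤y y≤z z<x with H.#-cotrans {z} {x} (inj₁ z<x) y
  ... | inj₁ (inj₁ z<y) = y≤z z<y
  ... | inj₁ (inj₂ y<z) = x≤y (O.trans y<z z<x)
  ... | inj₂ (inj₁ y<x) = x≤y y<x
  ... | inj₂ (inj₂ x<y) = y≤z (O.trans z<x x<y)

  <⇒≤ : ∀ {x y} → x < y → x ≤ y
  <⇒≤ x<y y<x = O.irrefl refl (O.trans x<y y<x)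

  ≤-preorder : Preorder c ℓ₁ ℓ₂
  ≤-preorder = record
    { isPreorder = record
      { isEquivalence = isEquivalence ; reflexive = ≤-reflexive ; trans = ≤-trans } }

  open PreorderReasoning ≤-preorder public

  +-monoˡ-≤ : ∀ {x y} z → x ≤ y → x + z ≤ y + z
  +-monoˡ-≤ {x} {y} z x≤y y+z<x+z = x≤y (<-resp (x+z-z≈x y z) (x+z-z≈x x z) (+-monoˡ-< (- z) y+z<x+z))

  x≤y⇒0≤y-x : ∀ {x y} → x ≤ y → 0# ≤ y - x
  x≤y⇒0≤y-x {x} {y} x≤y = begin
    0#     ≈⟨ -‿inverseʳ x ⟨
    x - x  ≲⟨ +-monoˡ-≤ (- x) x≤y ⟩
    y - x  ∎

  0≤y-x⇒x≤y : ∀ {x y} → 0# ≤ y - x → x ≤ y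
  0≤y-x⇒x≤y {x} {y} 0≤y-x = begin
    x          ≈⟨ +-identityˡ x ⟨
    0# + x     ≲⟨ +-monoˡ-≤ x 0≤y-x ⟩
    y - x + x  ≈⟨ x-z+z≈x y x ⟩
    y          ∎

  +-monoʳ-≤ : ∀ {x y} z → x ≤ y → z + x ≤ z + y
  +-monoʳ-≤ {x} {y} z x≤y = begin
    z + x ≈⟨ +-comm z x ⟩
    x + z ≲⟨ +-monoˡ-≤ z x≤y ⟩
    y + z ≈⟨ +-comm y z ⟩
    z + y ∎

  +-mono-≤ : ∀ {x y u v} → x ≤ y → u ≤ v → x + u ≤ y + v
  +-mono-≤ {y = y} {u} x≤y u≤v = ≤-trans (+-monoˡ-≤ u x≤y) (+-monoʳ-≤ y u≤v)

  invertible⇒#0 : ∀ {x y} → x * y ≈ 1# → x # 0#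
  invertible⇒#0 {x} {y} xy≈1 = H.invertible⇒#
    (y , trans (*-congˡ (x-0≈x x)) (trans (*-comm y x) xy≈1) , trans (*-congʳ (x-0≈x x)) xy≈1)

  0≤x∧x#0⇒0<x : ∀ {x} → 0# ≤ x → x # 0# → 0# < x
  0≤x∧x#0⇒0<x 0≤x (inj₁ x<0) = contradiction x<0 0≤x
  0≤x∧x#0⇒0<x 0≤x (inj₂ 0<x) = 0<x

  -- If x * y < 0 then x * y is invertible, so both factors are apart from 0, hence positive.
  *-nonneg : ∀ {x y} → 0# ≤ x → 0# ≤ y → 0# ≤ x * y
  *-nonneg {x} {y} 0≤x 0≤y xy<0 with H.#⇒invertible (inj₁ xy<0)
  ... | i , _ , xy-0*i≈1 = <⇒≤ (*-pos (0≤x∧x#0⇒0<x 0≤x (invertible⇒#0 x[yi]≈1))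
                                       (0≤x∧x#0⇒0<x 0≤y (invertible⇒#0 y[xi]≈1))) xy<0
    where
    xyi≈1 : x * y * i ≈ 1#
    xyi≈1 = trans (*-congʳ (sym (x-0≈x (x * y)))) xy-0*i≈1
    x[yi]≈1 : x * (y * i) ≈ 1#
    x[yi]≈1 = trans (sym (*-assoc x y i)) xyi≈1
    y[xi]≈1 : y * (x * i) ≈ 1#
    y[xi]≈1 = trans (sym (*-assoc y x i)) (trans (*-congʳ (*-comm y x)) xyi≈1)

  *-monoˡ-≤ : ∀ {x y} z → 0# ≤ z → x ≤ y → z * x ≤ z * y
  *-monoˡ-≤ {x} {y} z 0≤z x≤y = 0≤y-x⇒x≤y (≤-trans (*-nonneg 0≤z (x≤y⇒0≤y-x x≤y))
    (≤-reflexive (x[y-z]≈xy-xz z y x)))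

  *-monoʳ-≤ : ∀ {x y} z → 0# ≤ z → x ≤ y → x * z ≤ y * z
  *-monoʳ-≤ {x} {y} z 0≤z x≤y = begin
    x * z ≈⟨ *-comm x z ⟩
    z * x ≲⟨ *-monoˡ-≤ z 0≤z x≤y ⟩
    z * y ≈⟨ *-comm z y ⟩
    y * z ∎

  *-monoˡ-< : ∀ {x y} z → 0# < z → x < y → z * x < z * y
  *-monoˡ-< {x} {y} z 0<z x<y = <-resp (+-identityˡ _)
    (trans (+-congʳ (x[y-z]≈xy-xz z y x)) (x-z+z≈x (z * y) (z * x)))
    (+-monoˡ-< (z * x) (*-pos 0<z 0<y-x))
    where
    0<y-x : 0# < y - x
    0<y-x = <-resp (-‿inverseʳ x) refl (+-monoˡ-< (- x) x<y)

  *-cancelˡ-≤ : ∀ {x y} z → 0# < z → z * x ≤ z * y → x ≤ y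
  *-cancelˡ-≤ z 0<z zx≤zy y<x = zx≤zy (*-monoˡ-< z 0<z y<x)

  x*y≤z⇒x≤z/y : ∀ {x y z} (0<y : 0# < y) → x * y ≤ z → x ≤ z / y [ 0<y ]
  x*y≤z⇒x≤z/y {x} {y} {z} 0<y xy≤z = *-cancelˡ-≤ y 0<y (begin
    y * x              ≈⟨ *-comm y x ⟩
    x * y              ≲⟨ xy≤z ⟩
    z                  ≈⟨ *-identityʳ z ⟨
    z * 1#             ≈⟨ *-congˡ i[y-0]≈1 ⟨
    z * (i * (y - 0#)) ≈⟨ *-congˡ (*-congˡ (x-0≈x y)) ⟩
    z * (i * y)        ≈⟨ *-assoc z i y ⟨
    z * i * y          ≈⟨ *-comm (z * i) y ⟩
    y * (z * i)        ∎)
    where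
    inverse = #⇒invertible {y} {0#} (inj₂ 0<y)
    i = proj₁ inverse
    i[y-0]≈1 = proj₁ (proj₂ inverse)

  fromℕ-+ : ∀ m n → fromℕ (m ℕ.+ n) ≈ fromℕ m + fromℕ n
  fromℕ-+ = MonoidMult.×-homo-+ +-monoid 1#

  fromℕ-* : ∀ m n → fromℕ (m ℕ.* n) ≈ fromℕ m * fromℕ n
  fromℕ-* = SemiringMult.×1-homo-* semiring

  0≤fromℕ : ∀ n → 0# ≤ fromℕ n
  0≤fromℕ zero    = O.irrefl refl
  0≤fromℕ (suc n) = <⇒≤ (fromℕ-suc-pos n)

  fromℕ-mono-≤ : ∀ {m n} → m ℕ.≤ n → fromℕ m ≤ fromℕ n
  fromℕ-mono-≤ {m} m≤n with k , ≡.refl ← ℕ.m≤n⇒∃[o]m+o≡n m≤n = begin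
    fromℕ m            ≈⟨ +-identityʳ _ ⟨
    fromℕ m + 0#       ≲⟨ +-monoʳ-≤ (fromℕ m) (0≤fromℕ k) ⟩
    fromℕ m + fromℕ k  ≈⟨ fromℕ-+ m k ⟨
    fromℕ (m ℕ.+ k)    ∎

  -- From a bound on the excess to a bound on the number of pins.

  private
    pull-out-n : ∀ b y n t → b * (y + n * t) ≈ b * y + n * (b * t)
    pull-out-n = solve 4 (λ b y n t → b :* (y :+ n :* t) := b :* y :+ n :* (b :* t)) refl

    regroup-pin-weight : ∀ a n s → a * (s * (n * n)) ≈ n * (a * n * s)
    regroup-pin-weight = solve 3 (λ a n s → a :* (s :* (n :* n)) := n :* (a :* n :* s)) refl

    regroup-scaled-pins : ∀ a n s → s * (a * a * n) ≈ a * (a * n * s)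
    regroup-scaled-pins = solve 3 (λ a n s → s :* (a :* a :* n) := a :* (a :* n :* s)) refl

  -- M p counts the ordered pairs of the N points which the pin p does not separate.
  module _ {a} {A : Set a} (α : Carrier) (q N : ℕ) (m M : A → ℕ) where

    private β = 1# - α

    -- For each exceptional pin, Cauchy-Schwarz and the bound on its number of values give N² ≤ β q
    -- M(p); these inequalities are added over `S`.
    N²∣S∣≤βq∑M : (S : List A) → (∀ {p} → p ∈ₗ S → N ℕ.* N ℕ.≤ m p ℕ.* M p) →
      (∀ {p} → p ∈ₗ S → fromℕ (m p) ≤ β * fromℕ q) →
      fromℕ (length S ℕ.* (N ℕ.* N)) ≤ β * fromℕ (q ℕ.* ∑ S M)
    N²∣S∣≤βq∑M []      N²≤mM m≤βq =
      ≤-reflexive (sym (trans (*-congˡ (reflexive (≡.cong fromℕ (ℕ.*-zeroʳ q)))) (zeroʳ β)))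
    N²∣S∣≤βq∑M (p ∷ S) N²≤mM m≤βq = begin
      fromℕ (N ℕ.* N ℕ.+ length S ℕ.* (N ℕ.* N))           ≈⟨ fromℕ-+ (N ℕ.* N) _ ⟩
      fromℕ (N ℕ.* N) + fromℕ (length S ℕ.* (N ℕ.* N))
        ≲⟨ +-mono-≤ N²≤βqM (N²∣S∣≤βq∑M S (N²≤mM ∘ there) (m≤βq ∘ there)) ⟩
      β * fromℕ (q ℕ.* M p) + β * fromℕ (q ℕ.* ∑ S M)      ≈⟨ distribˡ β _ _ ⟨
      β * (fromℕ (q ℕ.* M p) + fromℕ (q ℕ.* ∑ S M))        ≈⟨ *-congˡ (fromℕ-+ (q ℕ.* M p) _) ⟨
      β * fromℕ (q ℕ.* M p ℕ.+ q ℕ.* ∑ S M)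
        ≡⟨ ≡.cong (λ n → β * fromℕ n) (ℕ.*-distribˡ-+ q (M p) _) ⟨
      β * fromℕ (q ℕ.* (M p ℕ.+ ∑ S M))                    ∎
      where
      N²≤βqM : fromℕ (N ℕ.* N) ≤ β * fromℕ (q ℕ.* M p)
      N²≤βqM = begin
        fromℕ (N ℕ.* N)              ≲⟨ fromℕ-mono-≤ (N²≤mM (here ≡.refl)) ⟩
        fromℕ (m p ℕ.* M p)          ≈⟨ fromℕ-* (m p) (M p) ⟩
        fromℕ (m p) * fromℕ (M p)    ≲⟨ *-monoʳ-≤ (fromℕ (M p)) (0≤fromℕ (M p)) (m≤βq (here ≡.refl)) ⟩
        β * fromℕ q * fromℕ (M p)    ≈⟨ *-assoc β _ _ ⟩
        β * (fromℕ q * fromℕ (M p))  ≈⟨ *-congˡ (fromℕ-* q (M p)) ⟨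
        β * fromℕ (q ℕ.* M p)        ∎

    -- The hypothesis on `q ℕ.* ∑ S M` says, without subtraction, that the total excess over `S` is
    -- at most N (u - v). Together with the previous bound this gives sN² ≤ β (sN² + N (u - v)) for
    -- s = |S|. As β = 1 - α, moving βsN² to the left leaves αsN², and one factor N cancels.
    ∣S∣≤β[u-v]/α²N : 0# < α → α ≤ 1# → 0 ℕ.< N →
      (S : List A) → (∀ {p} → p ∈ₗ S → N ℕ.* N ℕ.≤ m p ℕ.* M p) →
      (∀ {p} → p ∈ₗ S → fromℕ (m p) ≤ β * fromℕ q) →
      (u v : ℕ) → q ℕ.* ∑ S M ℕ.+ N ℕ.* v ℕ.≤ length S ℕ.* (N ℕ.* N) ℕ.+ N ℕ.* u →
      (0<α²N : 0# < α * α * fromℕ N) →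
      fromℕ (length S) ≤ (β * (fromℕ u - fromℕ v)) / (α * α * fromℕ N) [ 0<α²N ]
    ∣S∣≤β[u-v]/α²N 0<α α≤1 0<N S N²≤mM m≤βq u v q∑M≤ 0<α²N = x*y≤z⇒x≤z/y 0<α²N (begin
      s * (α * α * n)        ≈⟨ regroup-scaled-pins α n s ⟩
      -- The argument yields the bound with a single factor α; the second factor enters here through
      -- α ≤ 1.
      α * (α * n * s)        ≲⟨ *-monoʳ-≤ (α * n * s) 0≤αns α≤1 ⟩
      1# * (α * n * s)       ≈⟨ *-identityˡ _ ⟩
      α * n * s              ≲⟨ αns≤βt ⟩
      β * (fromℕ u - fromℕ v) ∎)
      where
      n = fromℕ N
      s = fromℕ (length S)
      0≤αns : 0# ≤ α * n * s
      0≤αns = *-nonneg (*-nonneg (<⇒≤ 0<α) (0≤fromℕ N)) (0≤fromℕ (length S))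
      s*n² : fromℕ (length S ℕ.* (N ℕ.* N)) ≈ s * (n * n)
      s*n² = trans (fromℕ-* (length S) _) (*-congˡ (fromℕ-* N N))
      q∑M≤ᴷ : fromℕ (q ℕ.* ∑ S M) ≤ s * (n * n) + n * fromℕ u - n * fromℕ v
      q∑M≤ᴷ = begin
        fromℕ (q ℕ.* ∑ S M)                              ≈⟨ x+z-z≈x _ (n * fromℕ v) ⟨
        fromℕ (q ℕ.* ∑ S M) + n * fromℕ v - n * fromℕ v
          ≈⟨ +-congʳ (trans (fromℕ-+ (q ℕ.* ∑ S M) (N ℕ.* v)) (+-congˡ (fromℕ-* N v))) ⟨
        fromℕ (q ℕ.* ∑ S M ℕ.+ N ℕ.* v) - n * fromℕ v    ≲⟨ +-monoˡ-≤ _ (fromℕ-mono-≤ q∑M≤) ⟩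
        fromℕ (length S ℕ.* (N ℕ.* N) ℕ.+ N ℕ.* u) - n * fromℕ v
          ≈⟨ +-congʳ (trans (fromℕ-+ (length S ℕ.* (N ℕ.* N)) (N ℕ.* u)) (+-cong s*n² (fromℕ-* N u))) ⟩
        s * (n * n) + n * fromℕ u - n * fromℕ v          ∎
      sn² = s * (n * n)
      nβt = n * (β * (fromℕ u - fromℕ v))
      sn²≤ : sn² ≤ β * sn² + nβt
      sn²≤ = begin
        sn²                                          ≈⟨ s*n² ⟨
        fromℕ (length S ℕ.* (N ℕ.* N))               ≲⟨ N²∣S∣≤βq∑M S N²≤mM m≤βq ⟩
        β * fromℕ (q ℕ.* ∑ S M)                      ≲⟨ *-monoˡ-≤ β (x≤y⇒0≤y-x α≤1) q∑M≤ᴷ ⟩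
        β * (sn² + n * fromℕ u - n * fromℕ v)
          ≈⟨ trans (*-congˡ (trans (+-assoc sn² _ _) (+-congˡ (sym (x[y-z]≈xy-xz n (fromℕ u) (fromℕ v))))))
                   (pull-out-n β sn² n _) ⟩
        β * sn² + nβt                                ∎
      αns≤βt : α * n * s ≤ β * (fromℕ u - fromℕ v)
      αns≤βt = *-cancelˡ-≤ n (fromℕ-pos 0<N) (begin
        n * (α * n * s)                    ≈⟨ regroup-pin-weight α n s ⟨
        α * sn²                            ≈⟨ -x+[x+y]≈y (β * sn²) (α * sn²) ⟨
        - (β * sn²) + (β * sn² + α * sn²)  ≈⟨ +-congˡ (x≈⟨1-a⟩x+ax α sn²) ⟨
        - (β * sn²) + sn²                  ≲⟨ +-monoʳ-≤ _ sn²≤ ⟩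
        - (β * sn²) + (β * sn² + nβt)      ≈⟨ -x+[x+y]≈y (β * sn²) nβt ⟩
        nβt                                ∎)

-- Enumeration of a finite field, its units and its vectors.

module FiniteFieldProperties {q : ℕ} (F : FiniteField q) where
  open FiniteField F
  open ≡ using (refl; sym; trans; cong; cong₂; subst; module ≡-Reasoning)
  private module H = IsHeytingField isHeytingField

  commutativeRing : CommutativeRing _ _
  commutativeRing = record { isCommutativeRing = H.isCommutativeRing }

  open CommutativeRing commutativeRing public
    using (ring; +-abelianGroup; +-commutativeSemigroup; +-assoc; +-comm; *-assoc;
           *-identityˡ; *-identityʳ; +-identityˡ; +-identityʳ; zeroˡ; zeroʳ; -‿inverseʳ)
  open RingIdentities commutativeRing public using (x-0≈x; x+z-z≈x; x-z+z≈x; [x-y]+[y-z]≈x-z)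
  open AbelianGroupProperties +-abelianGroup public using (⁻¹-anti-homo‿-; ⁻¹-∙-comm)
  open CommutativeSemigroupProperties +-commutativeSemigroup using (interchange)
  open RingProperties ring public using (+-cancelˡ)

  [x+y]-[u+v]≡[x-u]+[y-v] : ∀ x y u v → (x + y) - (u + v) ≡ (x - u) + (y - v)
  [x+y]-[u+v]≡[x-u]+[y-v] x y u v = trans (cong (x + y +_) (sym (⁻¹-∙-comm u v))) (interchange x y (- u) (- v))

  inverse : ∀ {s} → s ≢ 0# → ∃ λ i → i * s ≡ 1#
  inverse {s} s≢0 with H.#⇒invertible s≢0
  ... | i , i[s-0]≡1 , _ = i , trans (cong (i *_) (sym (x-0≈x s))) i[s-0]≡1

  1≢0 : 1# ≢ 0#
  1≢0 = H.invertible⇒# (1# , trans (*-identityˡ _) (x-0≈x 1#) , trans (*-identityʳ _) (x-0≈x 1#))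

  scalars : List Carrier
  scalars = map (Inverse.from enumeration) (allFin q)

  scalars-unique : Unique scalars
  scalars-unique = Unique.map⁺ from-injective (Unique.allFin⁺ q)
    where
    from-injective : ∀ {i j} → Inverse.from enumeration i ≡ Inverse.from enumeration j → i ≡ j
    from-injective {i} {j} eq = trans (sym (Inverse.strictlyInverseˡ enumeration i))
      (trans (cong (Inverse.to enumeration) eq) (Inverse.strictlyInverseˡ enumeration j))

  ∈-scalars : ∀ s → s ∈ₗ scalars
  ∈-scalars s = subst (_∈ₗ scalars) (Inverse.strictlyInverseʳ enumeration s)
    (∈-map⁺ _ (∈-allFin (Inverse.to enumeration s)))

  length-scalars : length scalars ≡ q
  length-scalars = trans (length-map _ (allFin q)) (length-tabulate _)

  nonzero? : ∀ s → Dec (s ≢ 0#)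
  nonzero? s = ¬? (s ≟ 0#)

  units : List Carrier
  units = filter nonzero? scalars

  units-unique : Unique units
  units-unique = Unique.filter⁺ nonzero? scalars-unique

  ∈-units⁺ : ∀ {s} → s ≢ 0# → s ∈ₗ units
  ∈-units⁺ {s} = ∈-filter⁺ nonzero? (∈-scalars s)

  ∈-units⁻ : ∀ {s} → s ∈ₗ units → s ≢ 0#
  ∈-units⁻ s∈ = proj₂ (∈-filter⁻ nonzero? {xs = scalars} s∈)

  q≡1+∣units∣ : q ≡ suc (length units)
  q≡1+∣units∣ = trans (sym length-scalars) (ℕ.≤-antisym
    (length-⊆ scalars (0# ∷ units) scalars-unique (λ {s} _ → split s))
    (length-⊆ (0# ∷ units) scalars (All.tabulate (λ s∈ 0≡s → ∈-units⁻ s∈ (sym 0≡s)) ∷ units-unique)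
              (λ {s} _ → ∈-scalars s)))
    where
    split : ∀ s → s ∈ₗ 0# ∷ units
    split s with s ≟ 0#
    ... | yes s≡0 = here s≡0
    ... | no  s≢0 = there (∈-units⁺ s≢0)

  0<∣units∣ : 0 ℕ.< length units
  0<∣units∣ = length-⊆ (1# ∷ []) units ([] ∷ []) 1∈
    where
    1∈ : ∀ {x} → x ∈ₗ 1# ∷ [] → x ∈ₗ units
    1∈ (here refl) = ∈-units⁺ 1≢0

  vectors : ∀ d → List (Vec Carrier d)
  vectors zero    = [] ∷ []
  vectors (suc d) = cartesianProductWith _∷_ scalars (vectors d)

  vectors-unique : ∀ d → Unique (vectors d)
  vectors-unique zero    = [] ∷ []
  vectors-unique (suc d) = Unique.cartesianProductWith⁺ _∷_ Vec.∷-injective scalars-unique (vectors-unique d)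

  ∈-vectors : ∀ {d} (x : Vec Carrier d) → x ∈ₗ vectors d
  ∈-vectors []      = here refl
  ∈-vectors (s ∷ x) = ∈-cartesianProductWith⁺ _∷_ (∈-scalars s) (∈-vectors x)

  length-vectors : ∀ d → length (vectors d) ≡ q ^ d
  length-vectors zero    = refl
  length-vectors (suc d) = trans (length-cartesianProductWith _∷_ scalars (vectors d))
    (cong₂ ℕ._*_ length-scalars (length-vectors d))

-- Vector arithmetic and functionals on the space of points.

module SpaceProperties {q : ℕ} (F : FiniteField q) (d : ℕ) where
  open FiniteField F
  open ≡ using (refl; sym; trans; cong; cong₂; subst; module ≡-Reasoning)
  open FiniteFieldProperties F
  open Space F d

  infix 4 _≟ᵛ_
  _≟ᵛ_ : DecidableEquality Point
  _≟ᵛ_ = Vec.≡-dec _≟_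

  points : List Point
  points = vectors d

  private
    zipWith-cancel : ∀ {f g : Carrier → Carrier → Carrier} → (∀ a b → g (f a b) b ≡ a) →
      ∀ {n} (x y : Vec Carrier n) → Vec.zipWith g (Vec.zipWith f x y) y ≡ x
    zipWith-cancel gf []      []      = refl
    zipWith-cancel gf (a ∷ x) (b ∷ y) = cong₂ _∷_ (gf a b) (zipWith-cancel gf x y)

  x+y-y≡x : ∀ x y → x +ᵛ y -ᵛ y ≡ x
  x+y-y≡x = zipWith-cancel x+z-z≈x

  x-y+y≡x : ∀ x y → x -ᵛ y +ᵛ y ≡ x
  x-y+y≡x = zipWith-cancel x-z+z≈x

  x-y≡0⇒x≡y : ∀ {x y} → x -ᵛ y ≡ 0ᵛ → x ≡ y
  x-y≡0⇒x≡y {x} {y} x-y≡0 = trans (sym (x-y+y≡x x y)) (trans (cong (_+ᵛ y) x-y≡0) (0ᵛ+ y))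
    where
    0ᵛ+ : ∀ {n} (y : Vec Carrier n) → Vec.zipWith _+_ (Vec.replicate n 0#) y ≡ y
    0ᵛ+ []      = refl
    0ᵛ+ (b ∷ y) = cong₂ _∷_ (+-identityˡ b) (0ᵛ+ y)

  [x-y]+[y-z]≡x-z : ∀ x y z → (x -ᵛ y) +ᵛ (y -ᵛ z) ≡ x -ᵛ z
  [x-y]+[y-z]≡x-z = go
    where
    go : ∀ {n} (x y z : Vec Carrier n) →
         Vec.zipWith _+_ (Vec.zipWith _-_ x y) (Vec.zipWith _-_ y z) ≡ Vec.zipWith _-_ x z
    go []      []      []      = refl
    go (a ∷ x) (b ∷ y) (c ∷ z) = cong₂ _∷_ ([x-y]+[y-z]≈x-z a b c) (go x y z)

  x-[y-z]≡[x-y]+z : ∀ x y z → x -ᵛ (y -ᵛ z) ≡ (x -ᵛ y) +ᵛ z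
  x-[y-z]≡[x-y]+z = go
    where
    go : ∀ {n} (x y z : Vec Carrier n) →
         Vec.zipWith _-_ x (Vec.zipWith _-_ y z) ≡ Vec.zipWith _+_ (Vec.zipWith _-_ x y) z
    go []      []      []      = refl
    go (a ∷ x) (b ∷ y) (c ∷ z) = cong₂ _∷_ (a-[b-c] a b c) (go x y z)
      where
      a-[b-c] : ∀ a b c → a - (b - c) ≡ a - b + c
      a-[b-c] a b c = begin
        a - (b - c)      ≡⟨ cong (a +_) (⁻¹-anti-homo‿- b c) ⟩
        a + (c - b)      ≡⟨ cong (a +_) (+-comm c (- b)) ⟩
        a + (- b + c)    ≡⟨ +-assoc a (- b) c ⟨
        a - b + c        ∎
        where open ≡-Reasoning

  •-assoc : ∀ s t x → s • (t • x) ≡ (s * t) • x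
  •-assoc s t x = trans (sym (Vec.map-∘ _ _ x)) (Vec.map-cong (λ a → sym (*-assoc s t a)) x)

  •-identity : ∀ x → 1# • x ≡ x
  •-identity x = trans (Vec.map-cong *-identityˡ x) (Vec.map-id x)

  s•0≡0 : ∀ s → s • 0ᵛ ≡ 0ᵛ
  s•0≡0 s = trans (Vec.map-replicate (s *_) 0# d) (cong (Vec.replicate d) (zeroʳ s))

  s•x≡y⇒x≡s⁻¹•y : ∀ {s x y} (s≢0 : s ≢ 0#) → s • x ≡ y → x ≡ proj₁ (inverse s≢0) • y
  s•x≡y⇒x≡s⁻¹•y {s} {x} {y} s≢0 s•x≡y = begin
    x            ≡⟨ •-identity x ⟨
    1# • x       ≡⟨ cong (_• x) is≡1 ⟨
    (i * s) • x  ≡⟨ •-assoc i s x ⟨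
    i • (s • x)  ≡⟨ cong (i •_) s•x≡y ⟩
    i • y        ∎
    where
    open ≡-Reasoning
    i = proj₁ (inverse s≢0)
    is≡1 = proj₂ (inverse s≢0)

  -- A nonvanishing point is found by searching the finite list of all points, and homogeneity
  -- rescales its value to 1. Nondegeneracy supplies the functionals to which this is applied.
  unitValue : (φ : Point → Carrier) → (∀ s x → φ (s • x) ≡ s * φ x) →
              ¬ (∀ x → φ x ≡ 0#) → ∃ λ u → φ u ≡ 1#
  unitValue φ homogeneous φ≢0 with any? (λ x → ¬? (φ x ≟ 0#)) points
  ... | no  ∄x = contradiction (λ x → decidable-stable (φ x ≟ 0#) (λ φx≢0 → ∄x (lose (∈-vectors x) φx≢0))) φ≢0
  ... | yes ∃x with x , _ , φx≢0 ← find ∃x with i , iφx≡1 ← inverse φx≢0 = i • x , trans (homogeneous i x) iφx≡1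

  -- The common interface through which distances and projections enter the double count. The law
  -- `shift-unshift` makes `unshift s` injective on pins, and `shear` says that a shift by `s`
  -- changes the difference of the two values by exactly `s`.
  record Shearing (f : Point → Point → Carrier) (x y : Point) : Set where
    field
      shift unshift : Carrier → Point → Point
      shift-unshift : ∀ s p → shift s (unshift s p) ≡ p
      shear         : ∀ s p → f (shift s p) x - f (shift s p) y ≡ f p x - f p y + s

  -- Double counting of pins and pairs of points.

  module Incidences (f : Point → Point → Carrier) (shearing : ∀ {x y} → x ≢ y → Shearing f x y)
                    (X : FinSubset Point) where

    private
      xs = elements X
      N  = length xs
      D  = q ^ d

    fibre : Point → Point → ℕ
    fibre x y = ∑ points (λ p → ⟦ f p y ≟ f p x ⟧)

    -- Averaging over the shifts: at most one of them moves a given pin into the fibre.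
    q*fibre≤qᵈ : ∀ {x y} → x ≢ y → q ℕ.* fibre x y ℕ.≤ D
    q*fibre≤qᵈ {x} {y} x≢y = begin
      q ℕ.* fibre x y                                   ≡⟨ cong (ℕ._* fibre x y) length-scalars ⟨
      length scalars ℕ.* fibre x y                      ≡⟨ ∑-const scalars _ ⟨
      ∑ scalars (λ _ → fibre x y)                       ≤⟨ ∑-mono scalars (λ {s} _ → fibre≤ s) ⟩
      ∑ scalars (λ s → ∑ points (h ∘ shift s))          ≡⟨ ∑-swap scalars points _ ⟩
      ∑ points (λ p → ∑ scalars (λ s → h (shift s p)))  ≤⟨ ∑-mono points (λ {p} _ →
                                                             ∑-atMostOne (λ s → f (shift s p) y ≟ f (shift s p) x)
                                                                         scalars scalars-unique (collide-once p)) ⟩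
      ∑ points (λ _ → 1)                                ≡⟨ ∑-const points 1 ⟩
      length points ℕ.* 1                               ≡⟨ ℕ.*-identityʳ _ ⟩
      length points                                     ≡⟨ length-vectors d ⟩
      D                                                 ∎
      where
      open ℕ.≤-Reasoning
      open Shearing (shearing x≢y)
      h : Point → ℕ
      h p = ⟦ f p y ≟ f p x ⟧
      unshift-injective : ∀ s {p r} → unshift s p ≡ unshift s r → p ≡ r
      unshift-injective s {p} {r} eq = trans (sym (shift-unshift s p)) (trans (cong (shift s) eq) (shift-unshift s r))
      -- Each pin `p` of the fibre reappears as `unshift s p`, which `shift s` moves back into the
      -- fibre; distinct pins reappear as distinct pins.
      fibre≤ : ∀ s → fibre x y ℕ.≤ ∑ points (h ∘ shift s)
      fibre≤ s = begin
        ∑ points h                          ≡⟨ ∑-cong points (λ {p} _ → cong h (shift-unshift s p)) ⟨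
        ∑ points (h ∘ shift s ∘ unshift s)  ≤⟨ ∑-inj points points (unshift s) (h ∘ shift s) (vectors-unique d)
                                                 (λ {p} _ → ∈-vectors (unshift s p)) (λ _ _ → unshift-injective s) ⟩
        ∑ points (h ∘ shift s)              ∎
      -- A shift that lands in the fibre satisfies `f p x - f p y + s ≡ 0#`, and this determines
      -- `s`.
      collide-once : ∀ p {s t} → f (shift s p) y ≡ f (shift s p) x → f (shift t p) y ≡ f (shift t p) x → s ≡ t
      collide-once p {s} {t} eq eq′ = +-cancelˡ (f p x - f p y) s t
        (trans (sym (shear s p)) (trans (vanish (sym eq)) (trans (sym (vanish (sym eq′))) (shear t p))))
        where
        vanish : ∀ {a b} → a ≡ b → a - b ≡ 0#
        vanish {a} refl = -‿inverseʳ a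

    -- One inequality for diagonal and off-diagonal pairs: q times the fibre is at most D + δ (qD -
    -- D), with the subtracted term moved to the left. On the diagonal the fibre consists of all D
    -- pins, so equality holds.
    q*fibre+δ≤ : ∀ x y → q ℕ.* fibre x y ℕ.+ ⟦ x ≟ᵛ y ⟧ ℕ.* D ℕ.≤ D ℕ.+ ⟦ x ≟ᵛ y ⟧ ℕ.* (q ℕ.* D)
    q*fibre+δ≤ x y with x ≟ᵛ y
    ... | no x≢y   = ℕ.+-monoˡ-≤ 0 (q*fibre≤qᵈ x≢y)
    ... | yes refl = begin
      q ℕ.* fibre x x ℕ.+ 1 ℕ.* D   ≡⟨ cong₂ ℕ._+_ (cong (q ℕ.*_) fibre≡D) (ℕ.*-identityˡ D) ⟩
      q ℕ.* D ℕ.+ D                 ≡⟨ ℕ.+-comm (q ℕ.* D) D ⟩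
      D ℕ.+ q ℕ.* D                 ≡⟨ cong (D ℕ.+_) (ℕ.*-identityˡ (q ℕ.* D)) ⟨
      D ℕ.+ 1 ℕ.* (q ℕ.* D)         ∎
      where
      open ℕ.≤-Reasoning
      fibre≡D : fibre x x ≡ D
      fibre≡D = trans (∑-cong points (λ {p} _ → ⟦⟧-true (f p x ≟ f p x) refl))
        (trans (∑-const points 1) (trans (ℕ.*-identityʳ _) (length-vectors d)))

    M : Point → ℕ
    M p = collisions _≟_ (f p) xs

    -- Swapping the sums counts pins for each pair instead of pairs for each pin. For each fixed `x`
    -- the `N` pairs contribute at most ND + qD - D, the last two terms coming from the single
    -- diagonal pair.
    q*∑M≤ : q ℕ.* ∑ points M ℕ.+ N ℕ.* D ℕ.≤ N ℕ.* (N ℕ.* D ℕ.+ q ℕ.* D)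
    q*∑M≤ = begin
      q ℕ.* ∑ points M ℕ.+ N ℕ.* D
        ≡⟨ cong₂ ℕ._+_ (cong (q ℕ.*_) ∑M) (sym (∑-const xs D)) ⟩
      q ℕ.* ∑ xs (λ x → ∑ xs (fibre x)) ℕ.+ ∑ xs (λ _ → D)
        ≡⟨ cong (ℕ._+ ∑ xs (λ _ → D)) (∑-*ˡ xs q _) ⟨
      ∑ xs (λ x → q ℕ.* ∑ xs (fibre x)) ℕ.+ ∑ xs (λ _ → D)   ≡⟨ ∑-+ xs _ _ ⟨
      ∑ xs (λ x → q ℕ.* ∑ xs (fibre x) ℕ.+ D)                ≤⟨ ∑-mono xs row ⟩
      ∑ xs (λ _ → N ℕ.* D ℕ.+ q ℕ.* D)                       ≡⟨ ∑-const xs _ ⟩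
      N ℕ.* (N ℕ.* D ℕ.+ q ℕ.* D)                            ∎
      where
      open ℕ.≤-Reasoning
      ∑M : ∑ points M ≡ ∑ xs (λ x → ∑ xs (fibre x))
      ∑M = trans (∑-swap points xs _) (∑-cong xs (λ _ → ∑-swap points xs _))
      row : ∀ {x} → x ∈ₗ xs → q ℕ.* ∑ xs (fibre x) ℕ.+ D ℕ.≤ N ℕ.* D ℕ.+ q ℕ.* D
      row {x} x∈ = begin
        q ℕ.* ∑ xs (fibre x) ℕ.+ D
          ≡⟨ cong₂ ℕ._+_ (∑-*ˡ xs q _) (∑-δ _≟ᵛ_ xs (λ _ → D) (unique X) x∈) ⟨
        ∑ xs (λ y → q ℕ.* fibre x y) ℕ.+ ∑ xs (λ y → ⟦ x ≟ᵛ y ⟧ ℕ.* D)  ≡⟨ ∑-+ xs _ _ ⟨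
        ∑ xs (λ y → q ℕ.* fibre x y ℕ.+ ⟦ x ≟ᵛ y ⟧ ℕ.* D)
          ≤⟨ ∑-mono xs (λ {y} _ → q*fibre+δ≤ x y) ⟩
        ∑ xs (λ y → D ℕ.+ ⟦ x ≟ᵛ y ⟧ ℕ.* (q ℕ.* D))                     ≡⟨ ∑-+ xs _ _ ⟩
        ∑ xs (λ _ → D) ℕ.+ ∑ xs (λ y → ⟦ x ≟ᵛ y ⟧ ℕ.* (q ℕ.* D))
          ≡⟨ cong₂ ℕ._+_ (∑-const xs D) (∑-δ _≟ᵛ_ xs (λ _ → q ℕ.* D) (unique X) x∈) ⟩
        N ℕ.* D ℕ.+ q ℕ.* D                                             ∎

    -- By Cauchy–Schwarz the subtraction is not truncated.
    excess : Point → ℕ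
    excess p = q ℕ.* M p ℕ.∸ N ℕ.* N

    -- The list of all q scalars contains every value, so Cauchy-Schwarz with that list gives N² ≤ q
    -- M(p) at every pin.
    N²+excess≡q*M : ∀ p → N ℕ.* N ℕ.+ excess p ≡ q ℕ.* M p
    N²+excess≡q*M p = ℕ.m+[n∸m]≡n (subst (λ k → N ℕ.* N ℕ.≤ k ℕ.* M p) length-scalars
      (length²≤∣values∣*collisions _≟_ (f p) xs scalars scalars-unique (λ {x} _ → ∈-scalars (f p x))))

    q*∑M≡N²+∑excess : ∀ ps → q ℕ.* ∑ ps M ≡ length ps ℕ.* (N ℕ.* N) ℕ.+ ∑ ps excess
    q*∑M≡N²+∑excess ps = begin
      q ℕ.* ∑ ps M                             ≡⟨ ∑-*ˡ ps q M ⟨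
      ∑ ps (λ p → q ℕ.* M p)                   ≡⟨ ∑-cong ps (λ {p} _ → N²+excess≡q*M p) ⟨
      ∑ ps (λ p → N ℕ.* N ℕ.+ excess p)        ≡⟨ ∑-+ ps _ _ ⟩
      ∑ ps (λ _ → N ℕ.* N) ℕ.+ ∑ ps excess     ≡⟨ cong (ℕ._+ ∑ ps excess) (∑-const ps _) ⟩
      length ps ℕ.* (N ℕ.* N) ℕ.+ ∑ ps excess  ∎
      where open ≡-Reasoning

    -- Over all D pins the terms N² add up to DN², which is exactly the main term of the double
    -- count. Cancelling it leaves the diagonal contribution N (qD - D).
    ∑excess≤ : ∑ points excess ℕ.+ N ℕ.* D ℕ.≤ N ℕ.* (q ℕ.* D)
    ∑excess≤ = ℕ.+-cancelˡ-≤ (D ℕ.* (N ℕ.* N)) _ _ (begin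
      D ℕ.* (N ℕ.* N) ℕ.+ (∑ points excess ℕ.+ N ℕ.* D)            ≡⟨ ℕ.+-assoc (D ℕ.* (N ℕ.* N)) _ _ ⟨
      D ℕ.* (N ℕ.* N) ℕ.+ ∑ points excess ℕ.+ N ℕ.* D
        ≡⟨ cong (λ k → k ℕ.* (N ℕ.* N) ℕ.+ ∑ points excess ℕ.+ N ℕ.* D) (length-vectors d) ⟨
      length points ℕ.* (N ℕ.* N) ℕ.+ ∑ points excess ℕ.+ N ℕ.* D
        ≡⟨ cong (ℕ._+ N ℕ.* D) (q*∑M≡N²+∑excess points) ⟨
      q ℕ.* ∑ points M ℕ.+ N ℕ.* D                                 ≤⟨ q*∑M≤ ⟩
      N ℕ.* (N ℕ.* D ℕ.+ q ℕ.* D)                                  ≡⟨ expand N D (q ℕ.* D) ⟩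
      D ℕ.* (N ℕ.* N) ℕ.+ N ℕ.* (q ℕ.* D)                          ∎)
      where
      open ℕ.≤-Reasoning
      expand : ∀ n k l → n ℕ.* (n ℕ.* k ℕ.+ l) ≡ k ℕ.* (n ℕ.* n) ℕ.+ n ℕ.* l
      expand = solve-∀

    N²≤∣image∣*M : ∀ p → N ℕ.* N ℕ.≤ ∣ image _≟_ (f p) X ∣ ℕ.* M p
    N²≤∣image∣*M p = length²≤∣values∣*collisions _≟_ (f p) xs _ (unique (image _≟_ (f p) X))
      (λ x∈ → ∈-deduplicate⁺ _≟_ (∈-map⁺ (f p) x∈))

  -- Pinned distances of a quadratic form.

  module Distances {Q : Point → Carrier} (Q-nondegenerate : IsNondegenerateQuadraticForm Q) where
    open IsNondegenerateQuadraticForm Q-nondegenerate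
    open IsQuadraticForm isQuadraticForm
    open IsNondegenerateBilinear polar-nondegenerate using (nondegenerateˡ)
    open IsBilinear polar-bilinear

    Q[x+y] : ∀ x y → Q (x +ᵛ y) ≡ polar Q x y + Q y + Q x
    Q[x+y] x y = sym (trans (cong (_+ Q x) (x-z+z≈x _ (Q y))) (x-z+z≈x _ (Q x)))

    -- Moving the pin by -w adds `polar Q (z -ᵛ p) w + Q w` to the value at `z`. The term `Q w` is
    -- the same for `x` and `y`, so their difference changes by `polar Q (x -ᵛ y) w`, which is
    -- linear in w. Nondegeneracy provides `u` with `polar Q (x -ᵛ y) u ≡ 1#`, and w = `s • u`
    -- produces the change `s`.
    distanceShearing : ∀ {x y} → x ≢ y → Shearing (λ p x → Q (x -ᵛ p)) x y
    distanceShearing {x} {y} x≢y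
      with u , polar≡1 ← unitValue (polar Q (x -ᵛ y)) (λ s → •-linearʳ s (x -ᵛ y))
                           (λ vanishes → x≢y (x-y≡0⇒x≡y (nondegenerateˡ _ vanishes)))
      = record
      { shift         = λ s p → p -ᵛ s • u
      ; unshift       = λ s p → p +ᵛ s • u
      ; shift-unshift = λ s p → x+y-y≡x p (s • u)
      ; shear         = λ s p → shear s p (s • u) refl
      }
      where
      open ≡-Reasoning
      Q[z-[p-w]] : ∀ z p w → Q (z -ᵛ (p -ᵛ w)) ≡ polar Q (z -ᵛ p) w + Q w + Q (z -ᵛ p)
      Q[z-[p-w]] z p w = trans (cong Q (x-[y-z]≡[x-y]+z z p w)) (Q[x+y] (z -ᵛ p) w)
      polar-difference : ∀ p w → polar Q (x -ᵛ p) w - polar Q (y -ᵛ p) w ≡ polar Q (x -ᵛ y) w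
      polar-difference p w = begin
        polar Q (x -ᵛ p) w - polar Q (y -ᵛ p) w
          ≡⟨ cong (λ z → polar Q z w - polar Q (y -ᵛ p) w) ([x-y]+[y-z]≡x-z x y p) ⟨
        polar Q ((x -ᵛ y) +ᵛ (y -ᵛ p)) w - polar Q (y -ᵛ p) w
          ≡⟨ cong (_- polar Q (y -ᵛ p) w) (+-linearˡ (x -ᵛ y) (y -ᵛ p) w) ⟩
        polar Q (x -ᵛ y) w + polar Q (y -ᵛ p) w - polar Q (y -ᵛ p) w  ≡⟨ x+z-z≈x _ _ ⟩
        polar Q (x -ᵛ y) w                                            ∎
      rearrange : ∀ a b c e g → (a + c + e) - (b + c + g) ≡ (e - g) + (a - b)
      rearrange a b c e g = begin
        (a + c + e) - (b + c + g)      ≡⟨ [x+y]-[u+v]≡[x-u]+[y-v] (a + c) e (b + c) g ⟩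
        ((a + c) - (b + c)) + (e - g)  ≡⟨ cong (_+ (e - g)) ([x+y]-[u+v]≡[x-u]+[y-v] a c b c) ⟩
        (a - b) + (c - c) + (e - g)    ≡⟨ cong (λ z → (a - b) + z + (e - g)) (-‿inverseʳ c) ⟩
        (a - b) + 0# + (e - g)         ≡⟨ cong (_+ (e - g)) (+-identityʳ (a - b)) ⟩
        (a - b) + (e - g)              ≡⟨ +-comm (a - b) (e - g) ⟩
        (e - g) + (a - b)              ∎
      shear : ∀ s p w → w ≡ s • u → Q (x -ᵛ (p -ᵛ w)) - Q (y -ᵛ (p -ᵛ w)) ≡ Q (x -ᵛ p) - Q (y -ᵛ p) + s
      shear s p w refl = begin
        Q (x -ᵛ (p -ᵛ w)) - Q (y -ᵛ (p -ᵛ w))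
          ≡⟨ cong₂ _-_ (Q[z-[p-w]] x p w) (Q[z-[p-w]] y p w) ⟩
        (polar Q (x -ᵛ p) w + Q w + Q (x -ᵛ p)) - (polar Q (y -ᵛ p) w + Q w + Q (y -ᵛ p))
          ≡⟨ rearrange _ _ (Q w) _ _ ⟩
        Q (x -ᵛ p) - Q (y -ᵛ p) + (polar Q (x -ᵛ p) w - polar Q (y -ᵛ p) w)
          ≡⟨ cong (Q (x -ᵛ p) - Q (y -ᵛ p) +_) (polar-difference p w) ⟩
        Q (x -ᵛ p) - Q (y -ᵛ p) + polar Q (x -ᵛ y) (s • u)
          ≡⟨ cong (Q (x -ᵛ p) - Q (y -ᵛ p) +_) (•-linearʳ s (x -ᵛ y) u) ⟩
        Q (x -ᵛ p) - Q (y -ᵛ p) + s * polar Q (x -ᵛ y) u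
          ≡⟨ cong (λ z → Q (x -ᵛ p) - Q (y -ᵛ p) + s * z) polar≡1 ⟩
        Q (x -ᵛ p) - Q (y -ᵛ p) + s * 1#
          ≡⟨ cong (Q (x -ᵛ p) - Q (y -ᵛ p) +_) (*-identityʳ s) ⟩
        Q (x -ᵛ p) - Q (y -ᵛ p) + s                                                       ∎

    module _ (P : FinSubset Point) where
      open Incidences (λ p x → Q (x -ᵛ p)) distanceShearing P public

      -- The excess is a natural number at every pin, so its sum over `S` is at most its sum over
      -- the whole space.
      q*∑M≤N²+Nqᵈ⁺¹ : (S : FinSubset Point) →
        q ℕ.* ∑ (elements S) M ℕ.+ ∣ P ∣ ℕ.* q ^ d ℕ.≤ ∣ S ∣ ℕ.* (∣ P ∣ ℕ.* ∣ P ∣) ℕ.+ ∣ P ∣ ℕ.* q ^ (d ℕ.+ 1)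
      q*∑M≤N²+Nqᵈ⁺¹ S = begin
        q ℕ.* ∑ ps M ℕ.+ N ℕ.* q ^ d
          ≡⟨ cong (ℕ._+ N ℕ.* q ^ d) (q*∑M≡N²+∑excess ps) ⟩
        ∣ S ∣ ℕ.* (N ℕ.* N) ℕ.+ ∑ ps excess ℕ.+ N ℕ.* q ^ d
          ≡⟨ ℕ.+-assoc (∣ S ∣ ℕ.* (N ℕ.* N)) _ _ ⟩
        ∣ S ∣ ℕ.* (N ℕ.* N) ℕ.+ (∑ ps excess ℕ.+ N ℕ.* q ^ d)      ≤⟨ ℕ.+-monoʳ-≤ (∣ S ∣ ℕ.* (N ℕ.* N)) (ℕ.+-monoˡ-≤ (N ℕ.* q ^ d)
                                                                        (∑-⊆ ps points excess (unique S) (λ {p} _ → ∈-vectors p))) ⟩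
        ∣ S ∣ ℕ.* (N ℕ.* N) ℕ.+ (∑ points excess ℕ.+ N ℕ.* q ^ d)
          ≤⟨ ℕ.+-monoʳ-≤ (∣ S ∣ ℕ.* (N ℕ.* N)) ∑excess≤ ⟩
        ∣ S ∣ ℕ.* (N ℕ.* N) ℕ.+ N ℕ.* (q ℕ.* q ^ d)
          ≡⟨ cong (λ k → ∣ S ∣ ℕ.* (N ℕ.* N) ℕ.+ N ℕ.* q ^ k) (ℕ.+-comm 1 d) ⟩
        ∣ S ∣ ℕ.* (N ℕ.* N) ℕ.+ N ℕ.* q ^ (d ℕ.+ 1)                ∎
        where
        open ℕ.≤-Reasoning
        ps = elements S
        N  = ∣ P ∣

  -- Projections along a bilinear pairing.

  module Projections {B : Point → Point → Carrier} (B-nondegenerate : IsNondegenerateBilinear B) where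
    open IsNondegenerateBilinear B-nondegenerate
    open IsBilinear isBilinear

    -‿linearʳ : ∀ x y z → B z (x -ᵛ y) ≡ B z x - B z y
    -‿linearʳ x y z = begin
      B z (x -ᵛ y)                  ≡⟨ x+z-z≈x _ (B z y) ⟨
      B z (x -ᵛ y) + B z y - B z y  ≡⟨ cong (_- B z y) (+-linearʳ z (x -ᵛ y) y) ⟨
      B z (x -ᵛ y +ᵛ y) - B z y     ≡⟨ cong (λ t → B z t - B z y) (x-y+y≡x x y) ⟩
      B z x - B z y                 ∎
      where open ≡-Reasoning

    -- The difference of the two values is `B p (x -ᵛ y)`, which is additive in the pin.
    -- Nondegeneracy in the right argument yields a direction `u` with `B u (x -ᵛ y) ≡ 1#`.
    projectionShearing : ∀ {x y} → x ≢ y → Shearing B x y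
    projectionShearing {x} {y} x≢y
      with u , B≡1 ← unitValue (λ p → B p (x -ᵛ y)) (λ s p → •-linearˡ s p (x -ᵛ y))
                       (λ vanishes → x≢y (x-y≡0⇒x≡y (nondegenerateʳ _ vanishes)))
      = record
      { shift         = λ s p → p +ᵛ s • u
      ; unshift       = λ s p → p -ᵛ s • u
      ; shift-unshift = λ s p → x-y+y≡x p (s • u)
      ; shear         = λ s p → begin
          B (p +ᵛ s • u) x - B (p +ᵛ s • u) y  ≡⟨ -‿linearʳ x y _ ⟨
          B (p +ᵛ s • u) (x -ᵛ y)              ≡⟨ +-linearˡ p (s • u) (x -ᵛ y) ⟩
          B p (x -ᵛ y) + B (s • u) (x -ᵛ y)    ≡⟨ cong₂ _+_ (-‿linearʳ x y p) (•-linearˡ s u (x -ᵛ y)) ⟩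
          B p x - B p y + s * B u (x -ᵛ y)     ≡⟨ cong (λ t → B p x - B p y + s * t) B≡1 ⟩
          B p x - B p y + s * 1#               ≡⟨ cong (B p x - B p y +_) (*-identityʳ s) ⟩
          B p x - B p y + s                    ∎
      }
      where open ≡-Reasoning

    -- Pairing with a point `u` such that `B p u ≡ 1#` recovers the scalar from a multiple of `p`.
    •-injectiveˡ : ∀ {s t p} → p ≢ 0ᵛ → s • p ≡ t • p → s ≡ t
    •-injectiveˡ {s} {t} {p} p≢0 s•p≡t•p
      with u , B≡1 ← unitValue (B p) (λ c → •-linearʳ c p) (λ vanishes → p≢0 (nondegenerateˡ p vanishes))
      = trans (sym (value s)) (trans (cong (λ z → B z u) s•p≡t•p) (value t))
      where
      value : ∀ c → B (c • p) u ≡ c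
      value c = trans (•-linearˡ c p u) (trans (cong (c *_) B≡1) (*-identityʳ c))

    module _ (Y : FinSubset Point) where
      open Incidences B projectionShearing Y public

      private
        ys = elements Y
        N  = ∣ Y ∣

      -- Scaling the pin multiplies all its values by the same unit, which neither creates nor
      -- destroys collisions.
      M-• : ∀ {s} p → s ≢ 0# → M (s • p) ≡ M p
      M-• {s} p s≢0 = ∑-cong ys (λ {x} _ → ∑-cong ys (λ {y} _ →
        ⟦⟧-cong (B (s • p) y ≟ B (s • p) x) (B p y ≟ B p x)
          (λ eq → *-cancelˡ (trans (sym (•-linearˡ s p y)) (trans eq (•-linearˡ s p x))))
          (λ eq → trans (•-linearˡ s p y) (trans (cong (s *_) eq) (sym (•-linearˡ s p x))))))
        where
        *-cancelˡ : ∀ {a b} → s * a ≡ s * b → a ≡ b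
        *-cancelˡ {a} {b} sa≡sb with i , is≡1 ← inverse s≢0 =
          trans (sym (unscale a)) (trans (cong (i *_) sa≡sb) (unscale b))
          where
          unscale : ∀ c → i * (s * c) ≡ c
          unscale c = trans (sym (*-assoc i s c)) (trans (cong (_* c) is≡1) (*-identityˡ c))

      M-0ᵛ : M 0ᵛ ≡ N ℕ.* N
      M-0ᵛ = trans (∑-cong ys (λ {x} _ → trans (∑-cong ys (λ {y} _ → ⟦⟧-true (B 0ᵛ y ≟ B 0ᵛ x) (trans (B0≡0 y) (sym (B0≡0 x)))))
                                               (trans (∑-const ys 1) (ℕ.*-identityʳ N))))
                   (∑-const ys N)
        where
        B0≡0 : ∀ x → B 0ᵛ x ≡ 0#
        B0≡0 x = trans (cong (λ z → B z x) (sym (s•0≡0 0#))) (trans (•-linearˡ 0# 0ᵛ x) (zeroˡ _))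

      -- This is q - 1, by `q≡1+∣units∣`.
      private r = length units

      excess-• : ∀ {s} p → s ≢ 0# → excess (s • p) ≡ excess p
      excess-• p s≢0 = cong (λ m → q ℕ.* m ℕ.∸ N ℕ.* N) (M-• p s≢0)

      excess-0ᵛ : excess 0ᵛ ≡ r ℕ.* (N ℕ.* N)
      excess-0ᵛ = ℕ.+-cancelˡ-≡ (N ℕ.* N) _ _
        (trans (N²+excess≡q*M 0ᵛ) (cong₂ ℕ._*_ q≡1+∣units∣ M-0ᵛ))

      module _ (S : FinSubset Point) (nonproportional : PairwiseNonproportional S)
               (nonzero : ∀ {p} → p ∈ S → p ≢ 0ᵛ) where

        private
          ps = elements S
          G  = ∑ ps excess
          D  = q ^ d

          -- The first entry represents the pin 0; its scalar `1#` is a unit, so `excess-•` applies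
          -- to it as to the other entries.
          multiples : List (Carrier × Point)
          multiples = (1# , 0ᵛ) ∷ cartesianProduct units ps

        multiples-unique : Unique multiples
        multiples-unique =
          All.tabulate (λ sp∈ eq → nonzero (proj₂ (∈-cartesianProduct⁻ units ps sp∈)) (sym (cong proj₂ eq)))
          ∷ Unique.cartesianProduct⁺ units-unique (unique S)

        multiple≢0 : ∀ {sp} → sp ∈ₗ cartesianProduct units ps → uncurry _•_ sp ≢ 0ᵛ
        multiple≢0 sp∈ s•p≡0 with s∈ , p∈ ← ∈-cartesianProduct⁻ units ps sp∈ =
          nonzero p∈ (trans (s•x≡y⇒x≡s⁻¹•y (∈-units⁻ s∈) s•p≡0) (s•0≡0 _))

        -- Equal multiples of one pin have equal scalars, and equal multiples of two different pins
        -- would make these proportional. The zero pin stays separate, because a unit times a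
        -- nonzero pin is nonzero.
        multiples-injective : ∀ {a b} → a ∈ₗ multiples → b ∈ₗ multiples →
                              uncurry _•_ a ≡ uncurry _•_ b → a ≡ b
        multiples-injective (here refl) (here refl) _  = refl
        multiples-injective (here refl) (there b∈)  eq = contradiction (trans (sym eq) (s•0≡0 1#)) (multiple≢0 b∈)
        multiples-injective (there a∈)  (here refl) eq = contradiction (trans eq (s•0≡0 1#)) (multiple≢0 a∈)
        multiples-injective {s , p} {t , p′} (there a∈) (there b∈) eq
          with s∈ , p∈ ← ∈-cartesianProduct⁻ units ps a∈ | _ , p′∈ ← ∈-cartesianProduct⁻ units ps b∈ | p ≟ᵛ p′
        ... | yes refl = cong (_, p) (•-injectiveˡ (nonzero p∈) eq)
        ... | no p≢p′  = contradiction (_ , trans (s•x≡y⇒x≡s⁻¹•y (∈-units⁻ s∈) eq) (•-assoc _ t p′))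
                                       (nonproportional p∈ p′∈ p≢p′)

        ∑multiples : ∑ multiples (excess ∘ uncurry _•_) ≡ r ℕ.* (N ℕ.* N ℕ.+ G)
        ∑multiples = begin
          excess (1# • 0ᵛ) ℕ.+ ∑ (cartesianProduct units ps) (excess ∘ uncurry _•_)
            ≡⟨ cong₂ ℕ._+_ (trans (excess-• 0ᵛ 1≢0) excess-0ᵛ) (∑-cartesianProduct units ps _) ⟩
          r ℕ.* (N ℕ.* N) ℕ.+ ∑ units (λ s → ∑ ps (λ p → excess (s • p)))
            ≡⟨ cong (r ℕ.* (N ℕ.* N) ℕ.+_) (∑-cong units (λ s∈ → ∑-cong ps (λ {p} _ → excess-• p (∈-units⁻ s∈)))) ⟩
          r ℕ.* (N ℕ.* N) ℕ.+ ∑ units (λ _ → G)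
            ≡⟨ cong (r ℕ.* (N ℕ.* N) ℕ.+_) (∑-const units G) ⟩
          r ℕ.* (N ℕ.* N) ℕ.+ r ℕ.* G
            ≡⟨ ℕ.*-distribˡ-+ r (N ℕ.* N) G ⟨
          r ℕ.* (N ℕ.* N ℕ.+ G)                                                      ∎
          where open ≡-Reasoning

        -- The total excess is at most N (qD - D) = rND, and the listed multiples already account
        -- for r (N² + G) of it. Cancelling r > 0 gives the bound; the term N² comes from the pin 0.
        N²+G≤Nqᵈ : N ℕ.* N ℕ.+ G ℕ.≤ N ℕ.* D
        N²+G≤Nqᵈ = ℕ.*-cancelˡ-≤ r ⦃ ℕ.>-nonZero 0<∣units∣ ⦄ (ℕ.+-cancelʳ-≤ (N ℕ.* D) _ _ (begin
          r ℕ.* (N ℕ.* N ℕ.+ G) ℕ.+ N ℕ.* D                      ≡⟨ cong (ℕ._+ N ℕ.* D) ∑multiples ⟨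
          ∑ multiples (excess ∘ uncurry _•_) ℕ.+ N ℕ.* D
            ≤⟨ ℕ.+-monoˡ-≤ (N ℕ.* D)
               (∑-inj points multiples (uncurry _•_) excess multiples-unique (λ _ → ∈-vectors _) multiples-injective) ⟩
          ∑ points excess ℕ.+ N ℕ.* D                            ≤⟨ ∑excess≤ ⟩
          N ℕ.* (q ℕ.* D)
            ≡⟨ cong (λ k → N ℕ.* (k ℕ.* D)) q≡1+∣units∣ ⟩
          N ℕ.* (suc r ℕ.* D)                                    ≡⟨ expand N r D ⟩
          r ℕ.* (N ℕ.* D) ℕ.+ N ℕ.* D                            ∎))
          where
          open ℕ.≤-Reasoning
          expand : ∀ n r k → n ℕ.* (suc r ℕ.* k) ≡ r ℕ.* (n ℕ.* k) ℕ.+ n ℕ.* k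
          expand = solve-∀

        q*∑M+N²≤N²+Nqᵈ : q ℕ.* ∑ ps M ℕ.+ N ℕ.* N ℕ.≤ ∣ S ∣ ℕ.* (N ℕ.* N) ℕ.+ N ℕ.* D
        q*∑M+N²≤N²+Nqᵈ = begin
          q ℕ.* ∑ ps M ℕ.+ N ℕ.* N                    ≡⟨ cong (ℕ._+ N ℕ.* N) (q*∑M≡N²+∑excess ps) ⟩
          ∣ S ∣ ℕ.* (N ℕ.* N) ℕ.+ G ℕ.+ N ℕ.* N       ≡⟨ ℕ.+-assoc (∣ S ∣ ℕ.* (N ℕ.* N)) G _ ⟩
          ∣ S ∣ ℕ.* (N ℕ.* N) ℕ.+ (G ℕ.+ N ℕ.* N)
            ≡⟨ cong (∣ S ∣ ℕ.* (N ℕ.* N) ℕ.+_) (ℕ.+-comm G _) ⟩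
          ∣ S ∣ ℕ.* (N ℕ.* N) ℕ.+ (N ℕ.* N ℕ.+ G)     ≤⟨ ℕ.+-monoʳ-≤ (∣ S ∣ ℕ.* (N ℕ.* N)) N²+G≤Nqᵈ ⟩
          ∣ S ∣ ℕ.* (N ℕ.* N) ℕ.+ N ℕ.* D             ∎
          where open ℕ.≤-Reasoning

-- Counting exceptional pins for distances and for projections.

proposition5p3 : ∀ {c ℓ₁ ℓ₂} (K : OrderedField c ℓ₁ ℓ₂) →
    let open OrderedField K in
    (d : ℕ) → 2 ℕ.≤ d →
    (α : Carrier) (0<α : 0# < α) → α ≤ 1# →
    ( (q : ℕ) → IsPrimePower q → ¬ (2 ∣ q) →
    (F : FiniteField q) →
    let open Space F d in
    (Q : Point → FiniteField.Carrier F) → IsNondegenerateQuadraticForm Q →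
    (P : FinSubset Point) (P≠∅ : Nonempty P) →
    (S : FinSubset Point) →
    (∀ {p} → p ∈ S → fromℕ ∣ Δ Q p P ∣ ≤ (1# - α) * fromℕ q) →
    fromℕ ∣ S ∣
    ≤ ((1# - α) * (fromℕ (q ℕ.^ (d ℕ.+ 1)) - fromℕ (q ℕ.^ d)))
    / (α * α * fromℕ ∣ P ∣) [ α²n-pos 0<α (Nonempty⇒0<∣∣ P P≠∅) ] )
    ×
    ( (q : ℕ) → IsPrimePower q →
    (F : FiniteField q) →
    let open Space F d in
    (Y : FinSubset Point) (Y≠∅ : Nonempty Y) →
    (B : Point → Point → FiniteField.Carrier F) → IsNondegenerateBilinear B →
    (S : FinSubset Point) →
    PairwiseNonproportional S →
    (∀ {p} → p ∈ S → p ≢ 0ᵛ) →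
    (∀ {p} → p ∈ S → fromℕ ∣ Π B p Y ∣ ≤ (1# - α) * fromℕ q) →
    fromℕ ∣ S ∣
    ≤ ((1# - α) * (fromℕ (q ℕ.^ d) - fromℕ ∣ Y ∣))
    / (α * α * fromℕ ∣ Y ∣) [ α²n-pos 0<α (Nonempty⇒0<∣∣ Y Y≠∅) ] )
proposition5p3 K d _ α 0<α α≤1 = distances , projections
  where
  open OrderedField K
  open OrderedFieldProperties K using (∣S∣≤β[u-v]/α²N)

  distances : (q : ℕ) → IsPrimePower q → ¬ (2 ∣ q) → (F : FiniteField q) →
    let open Space F d in
    (Q : Point → FiniteField.Carrier F) → IsNondegenerateQuadraticForm Q →
    (P : FinSubset Point) (P≠∅ : Nonempty P) (S : FinSubset Point) →
    (∀ {p} → p ∈ S → fromℕ ∣ Δ Q p P ∣ ≤ (1# - α) * fromℕ q) →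
    fromℕ ∣ S ∣
    ≤ ((1# - α) * (fromℕ (q ℕ.^ (d ℕ.+ 1)) - fromℕ (q ℕ.^ d)))
    / (α * α * fromℕ ∣ P ∣) [ α²n-pos 0<α (Nonempty⇒0<∣∣ P P≠∅) ]
  distances q _ _ F Q Q-nondegenerate P P≠∅ S few =
    ∣S∣≤β[u-v]/α²N α q (∣ P ∣) (λ p → ∣ Δ Q p P ∣) (M P) 0<α α≤1 (Nonempty⇒0<∣∣ P P≠∅) (elements S)
      (λ {p} _ → N²≤∣image∣*M P p) few (q ℕ.^ (d ℕ.+ 1)) (q ℕ.^ d) (q*∑M≤N²+Nqᵈ⁺¹ P S) _
    where
    open Space F d using (Δ)
    open SpaceProperties.Distances F d Q-nondegenerate

  projections : (q : ℕ) → IsPrimePower q → (F : FiniteField q) →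
    let open Space F d in
    (Y : FinSubset Point) (Y≠∅ : Nonempty Y) →
    (B : Point → Point → FiniteField.Carrier F) → IsNondegenerateBilinear B →
    (S : FinSubset Point) → PairwiseNonproportional S → (∀ {p} → p ∈ S → p ≢ 0ᵛ) →
    (∀ {p} → p ∈ S → fromℕ ∣ Π B p Y ∣ ≤ (1# - α) * fromℕ q) →
    fromℕ ∣ S ∣
    ≤ ((1# - α) * (fromℕ (q ℕ.^ d) - fromℕ ∣ Y ∣))
    / (α * α * fromℕ ∣ Y ∣) [ α²n-pos 0<α (Nonempty⇒0<∣∣ Y Y≠∅) ]
  projections q _ F Y Y≠∅ B B-nondegenerate S nonproportional nonzero few =
    -- Here the excess over `S` is at most N (q^d - N), hence u = q^d and v = N = |Y|.
    ∣S∣≤β[u-v]/α²N α q (∣ Y ∣) (λ p → ∣ Π B p Y ∣) (M Y) 0<α α≤1 (Nonempty⇒0<∣∣ Y Y≠∅) (elements S)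
      (λ {p} _ → N²≤∣image∣*M Y p) few (q ℕ.^ d) (∣ Y ∣) (q*∑M+N²≤N²+Nqᵈ Y S nonproportional nonzero) _
    where
    open Space F d using (Π)
    open SpaceProperties.Projections F d B-nondegenerate
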